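{- For every integer $k \geq 1$, ${\delta_{\text{poly-rem}}}(C_{2k+1}) = \frac{1}{2k+1}$, where $C_{2k+1}$ is the cycle of length $2k+1$.
   Context: All graphs are finite and simple; "copies" of a fixed graph $H$ in a graph $G$ are labeled copies, i.e. injective maps $V(H)\to V(G)$ sending edges to edges; $\delta(G)$ denotes the minimum degree of $G$. For a graph $H$, $\varepsilon>0$ and $\gamma\in[0,1]$, let $\delta(\varepsilon,H;\gamma)$ be the maximum $\delta\in[0,1]$ such that every $n$-vertex graph $G$ with minimum degree at least $\gamma n$ which contains $\varepsilon n^2$ edge-disjoint copies of $H$ contains at least $\delta n^{v(H)}$ copies of $H$. The polynomial removal threshold ${\delta_{\text{poly-rem}}}(H)$ is the infimum of those $\gamma$ for which there exists $\mu=\mu(\gamma)>0$ such that $\delta(\varepsilon,H;\gamma)\geq \mu\varepsilon^{1/\mu}$ for all $\varepsilon>0$. -}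

module Defs where

open import Data.Bool using (Bool; true; false; _∧_; _∨_; not; T; if_then_else_)
open import Data.Nat as ℕ using (ℕ; zero; suc; _≡ᵇ_)
open import Data.Fin using (Fin; toℕ; _≟_)
open import Data.Vec using (Vec; []; _∷_; lookup)
open import Data.List using (List; []; _∷_; map; concatMap; allFin; filterᵇ; length)
open import Data.Nat.ListAction using (sum)
open import Data.Bool.ListAction using (and)
open import Data.List.Relation.Unary.All using (All)
open import Data.List.Relation.Unary.AllPairs using (AllPairs)
open import Data.Integer using (+_)
open import Data.Rational using (ℚ; _/_; _*_; _≤_; _<_; 0ℚ; 1ℚ)
open import Data.Product using (Σ; _×_; ∃; ∃-syntax; _,_)
open import Relation.Nullary using (¬_; does)
open import Relation.Binary.PropositionalEquality using (_≡_)

Graph : ℕ → Set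
Graph n = Fin n → Fin n → Bool

record SimpleGraph (n : ℕ) : Set where
  field
    adj    : Graph n
    sym    : ∀ i j → adj i j ≡ adj j i
    irrefl : ∀ i → adj i i ≡ false
open SimpleGraph public

-- The cycle C_L on vertices 0,1,…,L-1, with i ~ i+1 and L-1 ~ 0.
-- (For L ≥ 3 this is the usual simple cycle of length L.)
cycleSucc : (L : ℕ) → Fin L → Fin L → Bool
cycleSucc L i j = (toℕ j ≡ᵇ suc (toℕ i)) ∨ ((toℕ j ≡ᵇ 0) ∧ (suc (toℕ i) ≡ᵇ L))

Cycle : (L : ℕ) → Graph L
Cycle L i j = cycleSucc L i j ∨ cycleSucc L j i

ℕtoℚ : ℕ → ℚ
ℕtoℚ n = + n / 1

infixr 8 _^ℚ_
_^ℚ_ : ℚ → ℕ → ℚ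
q ^ℚ zero  = 1ℚ
q ^ℚ suc m = q * (q ^ℚ m)

degree : {n : ℕ} → SimpleGraph n → Fin n → ℕ
degree {n} G i = sum (map (λ j → if adj G i j then 1 else 0) (allFin n))

MinDegreeAtLeast : {n : ℕ} → SimpleGraph n → ℚ → Set
MinDegreeAtLeast {n} G γ = ∀ i → γ * ℕtoℚ n ≤ ℕtoℚ (degree G i)

-- Labeled copies of a fixed graph H (on Fin v) in G (on Fin n):
-- injective maps Fin v → Fin n (represented as vectors) sending edges to edges.

isCopyᵇ : {v n : ℕ} → Graph v → SimpleGraph n → Vec (Fin n) v → Bool
isCopyᵇ {v} H G f =
  and (concatMap (λ a → map (λ b →
         (does (a ≟ b) ∨ not (does (lookup f a ≟ lookup f b)))
       ∧ (not (H a b) ∨ adj G (lookup f a) (lookup f b)))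
       (allFin v)) (allFin v))

IsCopy : {v n : ℕ} → Graph v → SimpleGraph n → Vec (Fin n) v → Set
IsCopy H G f = T (isCopyᵇ H G f)

allMaps : (n v : ℕ) → List (Vec (Fin n) v)
allMaps n zero    = [] ∷ []
allMaps n (suc v) = concatMap (λ x → map (x ∷_) (allMaps n v)) (allFin n)

copyCount : {v n : ℕ} → Graph v → SimpleGraph n → ℕ
copyCount {v} {n} H G = length (filterᵇ (isCopyᵇ H G) (allMaps n v))

EdgeDisjoint : {v n : ℕ} → Graph v → Vec (Fin n) v → Vec (Fin n) v → Set
EdgeDisjoint H f g = ∀ a b c d → T (H a b) → T (H c d) →
  ¬ (lookup f a ≡ lookup g c × lookup f b ≡ lookup g d)

HasEdgeDisjointCopies : {v n : ℕ} → Graph v → SimpleGraph n → ℚ → Set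
HasEdgeDisjointCopies {v} {n} H G ε =
  ∃[ fs ] (All (IsCopy H G) fs × AllPairs (EdgeDisjoint H) fs
           × ε * ℕtoℚ (n ℕ.* n) ≤ ℕtoℚ (length fs))

-- Polynomial removal.
-- With μ = p/q (p, q ≥ 1), the statement  δ(ε,H;γ) ≥ μ ε^{1/μ}  says that
-- every n-vertex G with δ(G) ≥ γn and ε n² edge-disjoint copies of H has
-- at least μ ε^{q/p} n^{v(H)} copies; both sides being nonnegative, this is
-- equivalent to  (p/q)^p · ε^q · n^{v p} ≤ (#copies)^p.

δ≥με^1/μ : {v : ℕ} → Graph v → ℚ → (p q : ℕ) → .{{_ : ℕ.NonZero q}} → ℚ → Set
δ≥με^1/μ {v} H γ p q ε =
  ∀ (n : ℕ) (G : SimpleGraph n) → MinDegreeAtLeast G γ →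
    HasEdgeDisjointCopies H G ε →
    ((+ p / q) ^ℚ p) * (ε ^ℚ q) * (ℕtoℚ (n ℕ.^ v) ^ℚ p) ≤ ℕtoℚ (copyCount H G) ^ℚ p

PolyRemoval : {v : ℕ} → Graph v → ℚ → Set
PolyRemoval H γ =
  ∃[ p ] ∃[ q ] Σ (ℕ.NonZero p) λ _ → Σ (ℕ.NonZero q) λ nz →
    ∀ (ε : ℚ) → 0ℚ < ε → δ≥με^1/μ H γ p q {{nz}} ε

-- t is the infimum of { γ ∈ [0,1] : PolyRemoval H γ } (the set is upward
-- closed, so this is equivalent to: every γ ∈ (t,1] is good and every
-- γ ∈ [0,t) is not).
IsPolyRemThreshold : {v : ℕ} → Graph v → ℚ → Set
IsPolyRemThreshold H t =
  (∀ γ → t < γ → γ ≤ 1ℚ → PolyRemoval H γ) ×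
  (∀ γ → 0ℚ ≤ γ → γ < t → ¬ PolyRemoval H γ)

{-# OPTIONS --safe #-}
module Submission where

-- Let L = 2k+1.
--
-- Above 1/L.  The degrees along a copy of C_L add up to more than n, so a positive
-- fraction of the vertices w is adjacent to two vertices of the copy, which are joined
-- inside the copy by a walk of length L - 2 (the odd arc, with some edge repeated).
-- Fix w, put R_0 = N(w), and let R_{j+1} consist of the vertices with at least θn
-- neighbours in R_j, where θ is a small multiple of ε.  Few edges lead from R_j to the
-- complement of R_{j+1}; as the copies are edge-disjoint, most of the walks above avoid
-- these edges, so their middle edges lie inside R_{k-1}.  Each such edge is in
-- (θn)^{2k-2} closed walks of length L through w, altogether poly(ε) n^L closed walks;
-- unless n is at most polynomial in 1/ε, most of these are copies of C_L.
--
-- Below 1/L.  Take layers V_0, …, V_{L-1} of integers and large layers U_0, …, U_{L-1}.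
-- Join x ∈ V_i to x + a ∈ V_{i+1} and x + (L-1)a ∈ V_{L-1} to x ∈ V_0 for a in a set
-- without nontrivial solutions of a_1 + … + a_{L-1} = (L-1)a, join V_i completely to U_i,
-- and U_i completely to U_{i+1}, but not U_{L-1} to U_0.  By parity a closed walk of
-- length L winds exactly once around the layers, hence stays in the V_i and is given by
-- its first two vertices, so there are at most n² copies of C_L.

open import Defs renaming (sym to adj-sym; irrefl to adj-irrefl)
import Algebra
import Algebra.Properties.CommutativeSemigroup
open import Data.Bool using (Bool; true; false; T; T?; _∧_; _∨_; not; if_then_else_)
open import Data.Bool.ListAction using (and)
open import Data.Bool.Properties using (T-≡; T-∧; T-∨; ∨-comm)
open import Data.Empty using (⊥; ⊥-elim)
open import Data.Fin using (Fin; zero; suc; toℕ; _≟_; fromℕ<; fromℕ; combine; remQuot; splitAt; join; inject₁)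
open import Data.Fin.Properties using (toℕ-injective; toℕ<n; toℕ-fromℕ<; toℕ-fromℕ; remQuot-combine; combine-remQuot; splitAt-join; join-splitAt; toℕ-inject₁)
import Data.Integer as ℤ
import Data.Integer.Properties as ℤ
open import Data.List using (List; []; _∷_; _++_; map; concatMap; length; filterᵇ; allFin; upTo; cartesianProduct; cartesianProductWith)
open import Data.List.Membership.Propositional using (_∈_)
open import Data.List.Membership.Propositional.Properties using (∈-allFin; ∈-∃++; ∈-++⁻; ∈-++⁺ˡ; ∈-++⁺ʳ; ∈-concatMap⁺; ∈-concatMap⁻; ∈-map⁺; ∈-map⁻; ∈-upTo⁺; ∈-cartesianProduct⁺; ∈-filter⁻)
open import Data.List.Properties using (length-tabulate; map-++; length-upTo; length-map)
open import Data.List.Relation.Unary.All as All using (All; []; _∷_)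
import Data.List.Relation.Unary.All.Properties as All
open import Data.List.Relation.Unary.AllPairs as AllPairs using (AllPairs; []; _∷_)
import Data.List.Relation.Unary.AllPairs.Properties as AllPairs
open import Data.List.Relation.Unary.Any as Any using (here; there)
open import Data.List.Relation.Unary.Unique.Propositional using (Unique)
open import Data.List.Relation.Unary.Unique.Propositional.Properties using (allFin⁺; map⁺; cartesianProduct⁺; cartesianProductWith⁺; filter⁺)
open import Data.Nat using (ℕ; zero; suc; pred; _+_; _*_; _^_; _∸_; ∣_-_∣; _≤_; _<_; z≤n; s≤s; _≡ᵇ_; _≤ᵇ_; NonZero; >-nonZero; >-nonZero⁻¹)
open import Data.Nat.DivMod using (_mod_; _%_; m%n<n; m<n⇒m%n≡m; n%n≡0)
open import Data.Nat.ListAction using (sum)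
open import Data.Nat.ListAction.Properties using (sum-++)
open import Data.Nat.Properties as ℕ hiding (_≟_)
open import Data.Nat.Tactic.RingSolver using (solve-∀)
open import Data.Product using (∃-syntax; ∃₂; _×_; _,_; proj₁; proj₂)
open import Data.Rational as ℚ using (ℚ; mkℚ; 0ℚ; _/_)
import Data.Rational.Properties as ℚ
open import Data.Rational.Unnormalised as ℚᵘ using (mkℚᵘ; *≡*; *≤*)
import Data.Rational.Unnormalised.Properties as ℚᵘ
open import Data.Sum using (_⊎_; inj₁; inj₂)
open import Data.Vec using (Vec; []; _∷_; lookup; head; tail; tabulate)
open import Data.Vec.Properties using (∷-injective; lookup∘tabulate; tabulate∘lookup; tabulate-cong)
open import Function using (_∘_; Equivalence)
open import Relation.Binary using (tri<; tri≈; tri>)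
open import Relation.Binary.PropositionalEquality
open import Relation.Nullary using (¬_; Dec; yes; no; does; contradiction)
open import Relation.Nullary.Decidable using (dec-true; dec-false; _×-dec_; _⊎-dec_)
open Algebra.Properties.CommutativeSemigroup (Algebra.CommutativeMonoid.commutativeSemigroup ℚ.*-1-commutativeMonoid) using (interchange)

-- Throughout, `k` is one less than in the theorem, so that `L` is `suc (2 * suc k)` and the last
-- reachable set is `reach k`. Above the threshold only closed walks are counted, so retracing an
-- edge costs nothing; walks with a repeated vertex are discarded at the end, at most
-- `L * L * n ^ (L - 1)` of them. If `n` is too small for that to be negligible, a single copy
-- already meets the required bound. Edge-disjointness enters once: each copy claims an edge of its
-- own, so few lost edges spoil few copies. Below the threshold the labels are `d ^ r` numbers below
-- a constant times `d * d * d ^ r`, the constant depending on `r` but not on `d`. Thus ε is of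
-- order `1 / (d * d)` for every `r`, while `n` exceeds `d ^ r`. The at most `n * n` copies are a
-- fraction at most `1 / n` of `n ^ L`, which falls below any fixed power of ε once `r` and then `d`
-- are large. Denominators are cleared and subtractions moved to the other side, so that nearly
-- everything takes place in the natural numbers.

private variable
  A B : Set

-- Finite sums

𝟙 : Bool → ℕ
𝟙 b = if b then 1 else 0

𝟙≤1 : ∀ b → 𝟙 b ≤ 1
𝟙≤1 true  = s≤s z≤n
𝟙≤1 false = z≤n

T⇒𝟙 : ∀ {b} → T b → 𝟙 b ≡ 1
T⇒𝟙 {true} _ = refl

∑ : List A → (A → ℕ) → ℕ
∑ xs f = sum (map f xs)

∑-mono : ∀ (xs : List A) {f g : A → ℕ} → (∀ x → f x ≤ g x) → ∑ xs f ≤ ∑ xs g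
∑-mono []       f≤g = z≤n
∑-mono (x ∷ xs) f≤g = +-mono-≤ (f≤g x) (∑-mono xs f≤g)

∑-cong : ∀ (xs : List A) {f g : A → ℕ} → (∀ x → f x ≡ g x) → ∑ xs f ≡ ∑ xs g
∑-cong []       f≡g = refl
∑-cong (x ∷ xs) f≡g = cong₂ _+_ (f≡g x) (∑-cong xs f≡g)

∑-+ : ∀ (xs : List A) (f g : A → ℕ) → ∑ xs (λ x → f x + g x) ≡ ∑ xs f + ∑ xs g
∑-+ []       f g = refl
∑-+ (x ∷ xs) f g rewrite ∑-+ xs f g = solve4 (f x) (g x) (∑ xs f) (∑ xs g)
  where
  solve4 : ∀ a b c d → a + b + (c + d) ≡ a + c + (b + d)
  solve4 = solve-∀

∑-*ˡ : ∀ (xs : List A) c (f : A → ℕ) → ∑ xs (λ x → c * f x) ≡ c * ∑ xs f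
∑-*ˡ []       c f = sym (*-zeroʳ c)
∑-*ˡ (x ∷ xs) c f = trans (cong (c * f x +_) (∑-*ˡ xs c f)) (sym (*-distribˡ-+ c (f x) _))

∑-*ʳ : ∀ (xs : List A) c (f : A → ℕ) → ∑ xs (λ x → f x * c) ≡ ∑ xs f * c
∑-*ʳ []       c f = refl
∑-*ʳ (x ∷ xs) c f = trans (cong (f x * c +_) (∑-*ʳ xs c f)) (sym (*-distribʳ-+ c (f x) _))

∑-const : ∀ (xs : List A) c → ∑ xs (λ _ → c) ≡ length xs * c
∑-const []       c = refl
∑-const (x ∷ xs) c = cong (c +_) (∑-const xs c)

∑-comm : ∀ (xs : List A) (ys : List B) (f : A → B → ℕ) →
         ∑ xs (λ x → ∑ ys (f x)) ≡ ∑ ys (λ y → ∑ xs (λ x → f x y))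
∑-comm []       ys f = sym (trans (∑-const ys 0) (*-zeroʳ (length ys)))
∑-comm (x ∷ xs) ys f =
  trans (cong (∑ ys (f x) +_) (∑-comm xs ys f)) (sym (∑-+ ys (f x) _))

∑-++ : ∀ (xs ys : List A) (f : A → ℕ) → ∑ (xs ++ ys) f ≡ ∑ xs f + ∑ ys f
∑-++ xs ys f = trans (cong sum (map-++ f xs ys)) (sum-++ (map f xs) (map f ys))

∑-map : ∀ (g : A → B) (xs : List A) (f : B → ℕ) → ∑ (map g xs) f ≡ ∑ xs (f ∘ g)
∑-map g []       f = refl
∑-map g (x ∷ xs) f = cong (f (g x) +_) (∑-map g xs f)

∑-concatMap : ∀ (g : A → List B) (xs : List A) (f : B → ℕ) →
              ∑ (concatMap g xs) f ≡ ∑ xs (λ x → ∑ (g x) f)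
∑-concatMap g []       f = refl
∑-concatMap g (x ∷ xs) f =
  trans (∑-++ (g x) (concatMap g xs) f) (cong (∑ (g x) f +_) (∑-concatMap g xs f))

∑-∈ : ∀ {xs : List A} {x} (f : A → ℕ) → x ∈ xs → f x ≤ ∑ xs f
∑-∈ {xs = _ ∷ xs} f (here refl) = m≤m+n _ _
∑-∈ {xs = y ∷ xs} f (there x∈) = ≤-trans (∑-∈ f x∈) (m≤n+m _ (f y))

∑-Fin-term : ∀ {n} (f : Fin n → ℕ) i → f i ≤ ∑ (allFin n) f
∑-Fin-term f i = ∑-∈ f (∈-allFin i)

length-allFin : ∀ n → length (allFin n) ≡ n
length-allFin n = length-tabulate {n = n} (λ i → i)

length-filterᵇ : ∀ (p : A → Bool) xs → length (filterᵇ p xs) ≡ ∑ xs (𝟙 ∘ p)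
length-filterᵇ p []       = refl
length-filterᵇ p (x ∷ xs) with p x
... | true  = cong suc (length-filterᵇ p xs)
... | false = length-filterᵇ p xs

∑-Unique-⊆ : ∀ (xs ys : List A) (f : A → ℕ) → Unique xs → (∀ {x} → x ∈ xs → x ∈ ys) →
             ∑ xs f ≤ ∑ ys f
∑-Unique-⊆ []       ys f []         sub = z≤n
∑-Unique-⊆ (x ∷ xs) ys f (x∉ ∷ uxs) sub with ∈-∃++ (sub (here refl))
... | as , bs , refl = begin
    f x + ∑ xs f                ≤⟨ +-monoʳ-≤ (f x) (∑-Unique-⊆ xs (as ++ bs) f uxs sub′) ⟩
    f x + ∑ (as ++ bs) f        ≡⟨ cong (f x +_) (∑-++ as bs f) ⟩
    f x + (∑ as f + ∑ bs f)     ≡⟨ sym (+-assoc (f x) _ _) ⟩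
    f x + ∑ as f + ∑ bs f       ≡⟨ cong (_+ ∑ bs f) (+-comm (f x) _) ⟩
    ∑ as f + f x + ∑ bs f       ≡⟨ +-assoc (∑ as f) _ _ ⟩
    ∑ as f + (f x + ∑ bs f)     ≡⟨ sym (∑-++ as (x ∷ bs) f) ⟩
    ∑ (as ++ x ∷ bs) f          ∎
  where
  open ≤-Reasoning
  sub′ : ∀ {y} → y ∈ xs → y ∈ as ++ bs
  sub′ {y} y∈ with ∈-++⁻ as (sub (there y∈))
  ... | inj₁ p            = ∈-++⁺ˡ p
  ... | inj₂ (here refl)  = contradiction refl (All.lookup x∉ y∈)
  ... | inj₂ (there p)    = ∈-++⁺ʳ as p

∑-allMaps-suc : ∀ n v (f : Vec (Fin n) (suc v) → ℕ) →
  ∑ (allMaps n (suc v)) f ≡ ∑ (allFin n) (λ x → ∑ (allMaps n v) (λ g → f (x ∷ g)))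
∑-allMaps-suc n v f = trans
  (∑-concatMap (λ x → map (x ∷_) (allMaps n v)) (allFin n) f)
  (∑-cong (allFin n) (λ x → ∑-map (x ∷_) (allMaps n v) f))

∑-allFin-const : ∀ n c → ∑ (allFin n) (λ _ → c) ≡ n * c
∑-allFin-const n c = trans (∑-const (allFin n) c) (cong (_* c) (length-allFin n))

length-allMaps : ∀ n v → length (allMaps n v) ≡ n ^ v
length-allMaps n v = trans (sym (trans (∑-const (allMaps n v) 1) (*-identityʳ _))) (go v)
  where
  go : ∀ v → ∑ (allMaps n v) (λ _ → 1) ≡ n ^ v
  go zero    = refl
  go (suc v) = trans (∑-allMaps-suc n v _)
    (trans (∑-cong (allFin n) (λ _ → go v)) (∑-allFin-const n (n ^ v)))

-- Walks and copies of the cycle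

T-and : ∀ {bs} → (∀ {b} → b ∈ bs → T b) → T (and bs)
T-and {[]}         h = _
T-and {true ∷ bs}  h = T-and {bs} (h ∘ there)
T-and {false ∷ bs} h = h (here refl)

and-T : ∀ {bs} → T (and bs) → ∀ {b} → b ∈ bs → T b
and-T {true ∷ bs} t (here refl) = _
and-T {true ∷ bs} t (there b∈)  = and-T {bs} t b∈

^-distribʳ-* : ∀ o m n → (m * n) ^ o ≡ m ^ o * n ^ o
^-distribʳ-* zero    m n = refl
^-distribʳ-* (suc o) m n = trans (cong (m * n *_) (^-distribʳ-* o m n)) (swap m n (m ^ o) (n ^ o))
  where
  swap : ∀ a b c d → a * b * (c * d) ≡ a * c * (b * d)
  swap = solve-∀

-- This repeats the conjunct tested by `isCopyᵇ`, so that its long conjunction can be traded for a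
-- quantifier over `a` and `b`.
copyAt : ∀ {v n} → Graph v → SimpleGraph n → Vec (Fin n) v → Fin v → Fin v → Bool
copyAt H G f a b = (does (a ≟ b) ∨ not (does (lookup f a ≟ lookup f b)))
                 ∧ (not (H a b) ∨ adj G (lookup f a) (lookup f b))

IsCopy⁺ : ∀ {v n} (H : Graph v) (G : SimpleGraph n) f →
  (∀ a b → T (copyAt H G f a b)) → IsCopy H G f
IsCopy⁺ {v} H G f h = T-and λ b∈ → go b∈
  where
  go : ∀ {c} → c ∈ concatMap (λ a → map (copyAt H G f a) (allFin v)) (allFin v) → T c
  go c∈ with ∈-concatMap⁻ (λ a → map (copyAt H G f a) (allFin v)) {xs = allFin v} c∈
  ... | p with Any.satisfied p
  ... | a , q with ∈-map⁻ (copyAt H G f a) q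
  ... | b , _ , refl = h a b

IsCopy⁻ : ∀ {v n} (H : Graph v) (G : SimpleGraph n) f →
  IsCopy H G f → ∀ a b → T (copyAt H G f a b)
IsCopy⁻ {v} H G f t a b = and-T t
  (∈-concatMap⁺ (λ a → map (copyAt H G f a) (allFin v)) {xs = allFin v}
    (Any.map (λ { refl → ∈-map⁺ (copyAt H G f a) (∈-allFin b) }) (∈-allFin a)))
IsCopy⇒adj : ∀ {v n} (H : Graph v) (G : SimpleGraph n) f → IsCopy H G f →
  ∀ a b → T (H a b) → T (adj G (lookup f a) (lookup f b))
IsCopy⇒adj H G f t a b hab
  with H a b | hab | Equivalence.to (T-∧ {does (a ≟ b) ∨ _}) (IsCopy⁻ H G f t a b)
... | true | _ | (_ , e) = e

module _ {n : ℕ} (G : SimpleGraph n) where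

  edge : Fin n → Fin n → ℕ
  edge u v = 𝟙 (adj G u v)

  -- The number of walks of length suc j.
  walks : ℕ → Fin n → Fin n → ℕ
  walks zero    u v = edge u v
  walks (suc j) u v = ∑ (allFin n) λ z → edge u z * walks j z v

  edge-sym : ∀ u v → edge u v ≡ edge v u
  edge-sym u v = cong 𝟙 (adj-sym G u v)

  -- A walk is split at its vertex after `suc i` steps. The index is one less than the length, hence
  -- the extra `suc` on the right.
  walks-conv : ∀ i j u v →
    ∑ (allFin n) (λ z → walks i u z * walks j z v) ≡ walks (suc (i + j)) u v
  walks-conv zero    j u v = refl
  walks-conv (suc i) j u v = begin
    ∑ V (λ z → ∑ V (λ y → edge u y * walks i y z) * walks j z v)
      ≡⟨ ∑-cong V (λ z → sym (∑-*ʳ V (walks j z v) _)) ⟩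
    ∑ V (λ z → ∑ V (λ y → edge u y * walks i y z * walks j z v))
      ≡⟨ ∑-comm V V _ ⟩
    ∑ V (λ y → ∑ V (λ z → edge u y * walks i y z * walks j z v))
      ≡⟨ ∑-cong V (λ y → trans (∑-cong V (λ z → *-assoc (edge u y) _ _)) (∑-*ˡ V (edge u y) _)) ⟩
    ∑ V (λ y → edge u y * ∑ V (λ z → walks i y z * walks j z v))
      ≡⟨ ∑-cong V (λ y → cong (edge u y *_) (walks-conv i j y v)) ⟩
    walks (suc (suc i + j)) u v ∎
    where
    open ≡-Reasoning
    V = allFin n

  walks-sym : ∀ j u v → walks j u v ≡ walks j v u
  walks-sym zero    u v = edge-sym u v
  walks-sym (suc j) u v = begin
    ∑ V (λ z → edge u z * walks j z v)
      ≡⟨ ∑-cong V (λ z → trans (*-comm (edge u z) _) (cong₂ _*_ (walks-sym j z v) (edge-sym u z))) ⟩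
    ∑ V (λ z → walks j v z * edge z u) ≡⟨ walks-conv j 0 v u ⟩
    walks (suc (j + 0)) v u            ≡⟨ cong (λ i → walks (suc i) v u) (+-identityʳ j) ⟩
    walks (suc j) v u ∎
    where
    open ≡-Reasoning
    V = allFin n

  -- A closed walk of odd length at `w` is cut at its middle edge `u v` into two walks of equal
  -- length that end at `w`.
  walks-through-middle : ∀ j w →
    ∑ (allFin n) (λ u → ∑ (allFin n) (λ v → edge u v * (walks j u w * walks j v w)))
      ≡ walks (2 * suc j) w w
  walks-through-middle j w = begin
    ∑ V (λ u → ∑ V (λ v → edge u v * (walks j u w * walks j v w)))
      ≡⟨ ∑-cong V (λ u → trans (∑-cong V (λ v → swap (edge u v) (walks j u w) (walks j v w))) (∑-*ˡ V (walks j u w) _)) ⟩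
    ∑ V (λ u → walks j u w * walks (suc j) u w)
      ≡⟨ ∑-cong V (λ u → cong (_* walks (suc j) u w) (walks-sym j u w)) ⟩
    ∑ V (λ u → walks j w u * walks (suc j) u w)
      ≡⟨ walks-conv j (suc j) w w ⟩
    walks (suc (j + suc j)) w w
      ≡⟨ cong (λ i → walks (suc i) w w) (cong (λ i → j + suc i) (sym (+-identityʳ j))) ⟩
    walks (2 * suc j) w w ∎
    where
    open ≡-Reasoning
    V = allFin n
    swap : ∀ a b c → a * (b * c) ≡ b * (a * c)
    swap = solve-∀

  pathᵇ : ∀ {j} → Fin n → Vec (Fin n) j → Fin n → Bool
  pathᵇ u []      v = adj G u v
  pathᵇ u (x ∷ f) v = adj G u x ∧ pathᵇ x f v

  𝟙-∧ : ∀ a b → 𝟙 (a ∧ b) ≡ 𝟙 a * 𝟙 b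
  𝟙-∧ true  b = sym (+-identityʳ _)
  𝟙-∧ false b = refl

  ∑-pathᵇ : ∀ j u v → ∑ (allMaps n j) (λ f → 𝟙 (pathᵇ u f v)) ≡ walks j u v
  ∑-pathᵇ zero    u v = +-identityʳ _
  ∑-pathᵇ (suc j) u v = trans (∑-allMaps-suc n j _) (∑-cong (allFin n) λ x →
    trans (∑-cong (allMaps n j) (λ f → 𝟙-∧ (adj G u x) _))
    (trans (∑-*ˡ (allMaps n j) (edge u x) _) (cong (edge u x *_) (∑-pathᵇ j x v))))

  -- Closed walks are encoded in the same type as candidate copies, so both can be counted within
  -- `allMaps`.
  closedᵇ : ∀ {j} → Vec (Fin n) (suc j) → Bool
  closedᵇ (w ∷ f) = pathᵇ w f w

  ∑-closedᵇ : ∀ j → ∑ (allMaps n (suc j)) (𝟙 ∘ closedᵇ) ≡ ∑ (allFin n) (λ w → walks j w w)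
  ∑-closedᵇ j = trans (∑-allMaps-suc n j _) (∑-cong (allFin n) λ w → ∑-pathᵇ j w w)

  path-step : ∀ {j} u (f : Vec (Fin n) j) v → T (pathᵇ u f v) → ∀ a b →
    toℕ b ≡ suc (toℕ a) → T (adj G (lookup (u ∷ f) a) (lookup (u ∷ f) b))
  path-step u (x ∷ f) v t zero    (suc zero) e = proj₁ (Equivalence.to T-∧ t)
  path-step u (x ∷ f) v t (suc a) (suc b)    e =
    path-step x f v (proj₂ (Equivalence.to (T-∧ {adj G u x}) t)) a b (cong pred e)

  path-last : ∀ {j} u (f : Vec (Fin n) j) v → T (pathᵇ u f v) → ∀ a →
    toℕ a ≡ j → T (adj G (lookup (u ∷ f) a) v)
  path-last u []      v t zero    e = t
  path-last u (x ∷ f) v t (suc a) e =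
    path-last x f v (proj₂ (Equivalence.to (T-∧ {adj G u x}) t)) a (cong pred e)

  closed-cycleSucc : ∀ {j} (g : Vec (Fin n) (suc j)) → T (closedᵇ g) → ∀ a b →
    T (cycleSucc (suc j) a b) → T (adj G (lookup g a) (lookup g b))
  closed-cycleSucc {j} g@(w ∷ f) t a b c with Equivalence.to (T-∨ {toℕ b ≡ᵇ suc (toℕ a)}) c
  ... | inj₁ e = path-step w f w t a b (≡ᵇ⇒≡ _ _ e)
  ... | inj₂ e with Equivalence.to (T-∧ {toℕ b ≡ᵇ 0}) e
  ... | e₁ , e₂ with b | ≡ᵇ⇒≡ (toℕ b) 0 e₁
  ... | zero | _ = path-last w f w t a (cong pred (≡ᵇ⇒≡ (suc (toℕ a)) (suc j) e₂))

  closed-Cycle : ∀ {j} (g : Vec (Fin n) (suc j)) → T (closedᵇ g) → ∀ a b →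
    T (Cycle (suc j) a b) → T (adj G (lookup g a) (lookup g b))
  closed-Cycle {j} g t a b c with Equivalence.to (T-∨ {cycleSucc (suc j) a b}) c
  ... | inj₁ e = closed-cycleSucc g t a b e
  ... | inj₂ e = subst T (adj-sym G _ _) (closed-cycleSucc g t b a e)

coincideᵇ : ∀ {v n} → Fin v → Fin v → Vec (Fin n) v → Bool
coincideᵇ a b f = not (does (a ≟ b)) ∧ does (lookup f a ≟ lookup f b)

∑-≟ : ∀ {n} (y : Fin n) → ∑ (allFin n) (λ x → 𝟙 (does (x ≟ y))) ≤ 1
∑-≟ {n} y = go (allFin n) (allFin⁺ n)
  where
  none : ∀ xs → All (y ≢_) xs → ∑ xs (λ x → 𝟙 (does (x ≟ y))) ≡ 0
  none []       []        = refl
  none (x ∷ xs) (p ∷ ps) rewrite dec-false (x ≟ y) (p ∘ sym) = none xs ps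
  go : ∀ xs → Unique xs → ∑ xs (λ x → 𝟙 (does (x ≟ y))) ≤ 1
  go []       []       = z≤n
  go (x ∷ xs) (p ∷ ps) with x ≟ y
  ... | yes refl rewrite none xs p = ≤-refl
  ... | no _ = go xs ps

-- One of the two coordinates is determined by the other, which costs a factor of `n`.
∑-coincide : ∀ n v (a b : Fin (suc v)) →
  ∑ (allMaps n (suc v)) (𝟙 ∘ coincideᵇ a b) ≤ n ^ v
∑-coincide n v a b with a ≟ b
... | yes p = ≤-trans (≤-reflexive (trans (∑-const (allMaps n (suc v)) 0) (*-zeroʳ (length (allMaps n (suc v)))))) z≤n
... | no a≢b = go v a b a≢b
  where
  first : ∀ v (b : Fin v) →
    ∑ (allFin n) (λ x → ∑ (allMaps n v) (λ g → 𝟙 (does (x ≟ lookup g b)))) ≤ n ^ v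
  first v b = begin
    _ ≡⟨ ∑-comm (allFin n) (allMaps n v) _ ⟩
    _ ≤⟨ ∑-mono (allMaps n v) (λ g → ∑-≟ (lookup g b)) ⟩
    _ ≡⟨ trans (∑-const (allMaps n v) 1) (*-identityʳ _) ⟩
    _ ≡⟨ length-allMaps n v ⟩
    n ^ v ∎
    where open ≤-Reasoning
  go : ∀ v (a b : Fin (suc v)) → a ≢ b →
    ∑ (allMaps n (suc v)) (λ f → 𝟙 (does (lookup f a ≟ lookup f b))) ≤ n ^ v
  go v zero    zero    a≢b = contradiction refl a≢b
  go v zero    (suc b) a≢b = ≤-trans (≤-reflexive (∑-allMaps-suc n v _)) (first v b)
  go v (suc a) zero    a≢b = ≤-trans (≤-reflexive (trans (∑-allMaps-suc n v _)
    (∑-cong (allFin n) λ x → ∑-cong (allMaps n v) λ g → swap (lookup g a) x))) (first v a)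
    where
    swap : ∀ (x y : Fin n) → 𝟙 (does (x ≟ y)) ≡ 𝟙 (does (y ≟ x))
    swap x y with x ≟ y
    ... | yes p = cong 𝟙 (sym (dec-true (y ≟ x) (sym p)))
    ... | no p  = cong 𝟙 (sym (dec-false (y ≟ x) (p ∘ sym)))
  go (suc v) (suc a) (suc b) a≢b = ≤-trans (≤-reflexive (∑-allMaps-suc n (suc v) _))
    (≤-trans (∑-mono (allFin n) λ _ → go v a b (a≢b ∘ cong suc)) (≤-reflexive (∑-allFin-const n (n ^ v))))

-- A closed walk preserves the edges of the cycle, so it can only fail to be a copy by repeating a
-- vertex; the error term is a union bound over pairs of positions.
closed≤copies+coincidences : ∀ {n} (G : SimpleGraph n) j →
  ∑ (allFin n) (λ w → walks G j w w) ≤ copyCount (Cycle (suc j)) G + suc j * (suc j * n ^ j)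
closed≤copies+coincidences {n} G j = begin
  ∑ (allFin n) (λ w → walks G j w w)
    ≡⟨ sym (∑-closedᵇ G j) ⟩
  ∑ (allMaps n L) (𝟙 ∘ closedᵇ G)
    ≤⟨ ∑-mono (allMaps n L) pointwise ⟩
  ∑ (allMaps n L) (λ g → 𝟙 (isCopyᵇ (Cycle L) G g) + coinc g)
    ≡⟨ ∑-+ (allMaps n L) _ _ ⟩
  ∑ (allMaps n L) (𝟙 ∘ isCopyᵇ (Cycle L) G) + ∑ (allMaps n L) coinc
    ≡⟨ cong₂ _+_ (sym (length-filterᵇ _ (allMaps n L)))
        (trans (∑-comm (allMaps n L) (allFin L) _) (∑-cong (allFin L) λ a → ∑-comm (allMaps n L) (allFin L) _)) ⟩
  copyCount (Cycle L) G + ∑ (allFin L) (λ a → ∑ (allFin L) λ b → ∑ (allMaps n L) (𝟙 ∘ coincideᵇ a b))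
    ≤⟨ +-monoʳ-≤ (copyCount (Cycle L) G) (∑-mono (allFin L) λ a → ∑-mono (allFin L) λ b → ∑-coincide n j a b) ⟩
  copyCount (Cycle L) G + ∑ (allFin L) (λ a → ∑ (allFin L) λ b → n ^ j)
    ≡⟨ cong (copyCount (Cycle L) G +_) (trans (∑-cong (allFin L) λ _ → ∑-allFin-const L (n ^ j)) (∑-allFin-const L (L * n ^ j))) ⟩
  copyCount (Cycle L) G + L * (L * n ^ j) ∎
  where
  open ≤-Reasoning
  L = suc j
  coinc : Vec (Fin n) L → ℕ
  coinc g = ∑ (allFin L) λ a → ∑ (allFin L) λ b → 𝟙 (coincideᵇ a b g)
  0≡coincide : ∀ g → coinc g ≡ 0 → ∀ a b → 𝟙 (coincideᵇ a b g) ≡ 0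
  0≡coincide g e a b = n≤0⇒n≡0 (≤-trans (∑-Fin-term (λ b → 𝟙 (coincideᵇ a b g)) b)
    (≤-trans (∑-Fin-term (λ a → ∑ (allFin L) λ b → 𝟙 (coincideᵇ a b g)) a) (≤-reflexive e)))
  copy-at : ∀ g → T (closedᵇ G g) → coinc g ≡ 0 → ∀ a b → T (copyAt (Cycle L) G g a b)
  copy-at g t e a b = Equivalence.from T-∧
    (distinct (does (a ≟ b)) (does (lookup g a ≟ lookup g b)) (0≡coincide g e a b) ,
     preserves (Cycle L a b) _ (closed-Cycle G g t a b))
    where
    distinct : ∀ x y → 𝟙 (not x ∧ y) ≡ 0 → T (x ∨ not y)
    distinct true  y     _ = _
    distinct false false _ = _
    preserves : ∀ x y → (T x → T y) → T (not x ∨ y)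
    preserves true  y h = h _
    preserves false y h = _
  pointwise : ∀ g → 𝟙 (closedᵇ G g) ≤ 𝟙 (isCopyᵇ (Cycle L) G g) + coinc g
  pointwise g with closedᵇ G g in eq | coinc g in e
  ... | false | _     = z≤n
  ... | true  | suc c = ≤-trans (s≤s z≤n) (m≤n+m (suc c) _)
  ... | true  | zero  = ≤-trans (≤-reflexive (sym (T⇒𝟙
        (IsCopy⁺ (Cycle L) G g (copy-at g (Equivalence.from T-≡ eq) e))))) (m≤m+n _ 0)

-- Odd walks inside the cycle

data Walk {v} (H : Graph v) (a : Fin v) : ℕ → Fin v → Set where
  stop : Walk H a 0 a
  _▸_  : ∀ {d b c} → Walk H a d b → T (H b c) → Walk H a (suc d) c

_▸▸_ : ∀ {v} {H : Graph v} {a b c d e} → Walk H a d b → Walk H b e c → Walk H a (e + d) c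
p ▸▸ stop    = p
p ▸▸ (q ▸ h) = (p ▸▸ q) ▸ h

splitWalk : ∀ {v} {H : Graph v} {a b d} e → Walk H a (e + d) b →
  ∃[ c ] (Walk H a d c × Walk H c e b)
splitWalk zero    p = _ , p , stop
splitWalk (suc e) (p ▸ h) with splitWalk e p
... | c , q , r = c , q , (r ▸ h)

Cycle-sym : ∀ L a b → T (Cycle L a b) → T (Cycle L b a)
Cycle-sym L a b t with Equivalence.to (T-∨ {cycleSucc L a b}) t
... | inj₁ x = Equivalence.from (T-∨ {cycleSucc L b a}) (inj₂ x)
... | inj₂ x = Equivalence.from (T-∨ {cycleSucc L b a}) (inj₁ x)

module _ {L : ℕ} where

  reverseWalk : ∀ {a b d} → Walk (Cycle L) a d b → Walk (Cycle L) b d a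
  reverseWalk stop = stop
  reverseWalk {a} {c} (_▸_ {d} {b} p h) =
    subst (λ i → Walk (Cycle L) c i a) (+-comm d 1) ((stop ▸ Cycle-sym L b c h) ▸▸ reverseWalk p)

  -- The last edge is retraced `e` times, which is why the given walk must be nonempty.
  padWalk : ∀ e {a b d} → Walk (Cycle L) a (suc d) b → Walk (Cycle L) a (2 * e + suc d) b
  padWalk zero    p = p
  padWalk (suc e) {a} {b} {d} p with padWalk e p | +-suc (2 * e) d
  ... | q | eq rewrite eq with q
  ... | _▸_ {b = c} r h = subst (λ i → Walk (Cycle L) a i b) (count e d)
    ((_▸_ {c = b} r h ▸ Cycle-sym L c b h) ▸ h)
    where
    count : ∀ e d → 3 + (2 * e + d) ≡ 2 * suc e + suc d
    count = solve-∀

  step-up : ∀ a b → toℕ b ≡ suc (toℕ a) → T (Cycle L a b)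
  step-up a b e = Equivalence.from (T-∨ {cycleSucc L a b}) (inj₁
    (Equivalence.from (T-∨ {toℕ b ≡ᵇ suc (toℕ a)}) (inj₁ (≡⇒≡ᵇ _ _ e))))

  step-wrap : ∀ a b → toℕ b ≡ 0 → suc (toℕ a) ≡ L → T (Cycle L a b)
  step-wrap a b e f = Equivalence.from (T-∨ {cycleSucc L a b}) (inj₁
    (Equivalence.from (T-∨ {toℕ b ≡ᵇ suc (toℕ a)}) (inj₂
      (Equivalence.from (T-∧ {toℕ b ≡ᵇ 0}) (≡⇒≡ᵇ _ _ e , ≡⇒≡ᵇ _ _ f)))))

  ascend : ∀ d a b → toℕ b ≡ d + toℕ a → Walk (Cycle L) a d b
  ascend zero    a b e = subst (Walk (Cycle L) a 0) (toℕ-injective (sym e)) stop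
  ascend (suc d) a b e =
    ascend d a c (toℕ-fromℕ< c<L) ▸ step-up c b (trans e (cong suc (sym (toℕ-fromℕ< c<L))))
    where
    c<L : d + toℕ a < L
    c<L = ≤-trans (≤-reflexive (sym e)) (<⇒≤ (toℕ<n b))
    c = fromℕ< c<L

-- This is the arc through the edge from the last vertex to `zero`: `r` steps up to it, one step
-- across, `toℕ a` steps further.
wrapWalk : ∀ {l} (a b : Fin (suc l)) r → toℕ b + r ≡ l →
  Walk (Cycle (suc l)) b (toℕ a + suc r) a
wrapWalk {l} a b r e =
  (ascend r b (fromℕ l) (trans (toℕ-fromℕ l) (trans (sym e) (+-comm _ r)))
    ▸ step-wrap (fromℕ l) zero refl (cong suc (toℕ-fromℕ l)))
  ▸▸ ascend (toℕ a) zero a (sym (+-identityʳ _))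

parity : ∀ d → ∃[ i ] (d ≡ 2 * i ⊎ d ≡ suc (2 * i))
parity zero    = 0 , inj₁ refl
parity (suc d) with parity d
... | i , inj₁ e = i , inj₂ (cong suc e)
... | i , inj₂ e = suc i , inj₁ (trans (cong suc e) (double-suc i))
  where
  double-suc : ∀ i → 2 + 2 * i ≡ 2 * suc i
  double-suc = solve-∀

-- One of the two arcs between distinct vertices is odd; going back and forth
-- along one of its edges brings its length up to L - 2.
oddWalk-< : ∀ k (a b : Fin (suc (2 * suc k))) → toℕ a < toℕ b →
  Walk (Cycle (suc (2 * suc k))) a (suc (2 * k)) b
oddWalk-< k a b a<b with parity (toℕ b ∸ toℕ a)
... | i , inj₂ e = subst (λ l → Walk (Cycle (suc (2 * suc k))) a l b) len (padWalk (k ∸ i) (ascend (suc (2 * i)) a b b≡))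
  where
  open ≤-Reasoning
  b≡ : toℕ b ≡ suc (2 * i) + toℕ a
  b≡ = trans (sym (m∸n+n≡m (<⇒≤ a<b))) (cong (_+ toℕ a) e)
  i≤k : i ≤ k
  i≤k = <⇒≤pred (*-cancelˡ-< 2 i (suc k) (begin-strict
    2 * i                 <⟨ n<1+n _ ⟩
    suc (2 * i)           ≤⟨ m≤m+n _ _ ⟩
    suc (2 * i) + toℕ a   ≡⟨ sym b≡ ⟩
    toℕ b                 ≤⟨ <⇒≤pred (toℕ<n b) ⟩
    2 * suc k             ∎))
  len : 2 * (k ∸ i) + suc (2 * i) ≡ suc (2 * k)
  len = trans (+-suc (2 * (k ∸ i)) (2 * i)) (cong suc
    (trans (sym (*-distribˡ-+ 2 (k ∸ i) i)) (cong (2 *_) (m∸n+n≡m i≤k))))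
... | zero , inj₁ e = contradiction (m∸n≡0⇒m≤n e) (<⇒≱ a<b)
-- An even difference `2 * suc i` leaves the other arc with odd length `L - 2 * suc i`; retracing an
-- edge `i` times brings it to `L - 2`.
... | suc i , inj₁ e = subst (λ l → Walk (Cycle (suc (2 * suc k))) a l b) len
    (padWalk i (reverseWalk (subst (λ l → Walk (Cycle (suc (2 * suc k))) b l a) (+-suc (toℕ a) r) (wrapWalk a b r r≡))))
  where
  r = 2 * suc k ∸ toℕ b
  r≡ : toℕ b + r ≡ 2 * suc k
  r≡ = m+[n∸m]≡n (<⇒≤pred (toℕ<n b))
  b≡ : toℕ b ≡ 2 * suc i + toℕ a
  b≡ = trans (sym (m∸n+n≡m (<⇒≤ a<b))) (cong (_+ toℕ a) e)
  arith : ∀ i a r → 2 * suc i + a + r ≡ suc (2 * i + suc (a + r))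
  arith = solve-∀
  arith₂ : ∀ k → 2 * suc k ≡ suc (suc (2 * k))
  arith₂ = solve-∀
  len : 2 * i + suc (toℕ a + r) ≡ suc (2 * k)
  len = cong pred (trans (sym (arith i (toℕ a) r)) (trans (cong (_+ r) (sym b≡)) (trans r≡ (arith₂ k))))

oddWalk : ∀ k (a b : Fin (suc (2 * suc k))) → a ≢ b →
  Walk (Cycle (suc (2 * suc k))) a (suc (2 * k)) b
oddWalk k a b a≢b with <-cmp (toℕ a) (toℕ b)
... | tri< a<b _ _ = oddWalk-< k a b a<b
... | tri≈ _ e _   = contradiction (toℕ-injective e) a≢b
... | tri> _ _ b<a = reverseWalk (oddWalk-< k b a b<a)

-- Choosing edges in edge-disjoint copies

two-witnesses : ∀ {A : Set} (p : A → Bool) xs → Unique xs → 2 ≤ ∑ xs (𝟙 ∘ p) →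
  ∃₂ λ x y → x ≢ y × T (p x) × T (p y)
two-witnesses p (x ∷ xs) (x∉ ∷ uxs) le with p x in eq
... | false = two-witnesses p xs uxs le
... | true  with one-witness xs (≤-pred le)
  where
  one-witness : ∀ ys → 1 ≤ ∑ ys (𝟙 ∘ p) → ∃[ y ] (y ∈ ys × T (p y))
  one-witness (y ∷ ys) le with p y in eq
  ... | true = y , here refl , Equivalence.from T-≡ eq
  ... | false with one-witness ys le
  ... | z , z∈ , pz = z , there z∈ , pz
... | y , y∈ , py = x , y , All.lookup x∉ y∈ , Equivalence.from T-≡ eq , py

∑-cartesianProduct : ∀ {A B : Set} (xs : List A) (ys : List B) (f : A × B → ℕ) →
  ∑ (cartesianProduct xs ys) f ≡ ∑ xs (λ x → ∑ ys (λ y → f (x , y)))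
∑-cartesianProduct []       ys f = refl
∑-cartesianProduct (x ∷ xs) ys f = trans (∑-++ (map (x ,_) ys) _ f)
  (cong₂ _+_ (∑-map (x ,_) ys f) (∑-cartesianProduct xs ys f))

-- Each hit copy selects one of its ordered edges of positive weight. Edge-disjointness makes the
-- selected pairs distinct, so their weights are distinct terms of the double sum.
∑-EdgeDisjoint : ∀ {v n} (H : Graph v) (χ : Fin n → Fin n → ℕ) (hit : Vec (Fin n) v → Bool) fs →
  All (λ f → T (hit f) → ∃₂ λ a b → T (H a b) × 1 ≤ χ (lookup f a) (lookup f b)) fs →
  AllPairs (EdgeDisjoint H) fs →
  ∑ fs (𝟙 ∘ hit) ≤ ∑ (allFin n) (λ x → ∑ (allFin n) (χ x))
∑-EdgeDisjoint {v} {n} H χ hit fs wit dis with choose fs wit dis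
  where
  χ′ : Fin n × Fin n → ℕ
  χ′ (x , y) = χ x y
  -- Every selected pair remembers a copy that owns it; comparing owners shows that the next
  -- selected pair is new.
  EdgeOf : List (Vec (Fin n) v) → Fin n × Fin n → Set
  EdgeOf fs e = ∃[ f ] (f ∈ fs × ∃₂ λ a b → T (H a b) × e ≡ (lookup f a , lookup f b))
  choose : ∀ fs →
    All (λ f → T (hit f) → ∃₂ λ a b → T (H a b) × 1 ≤ χ (lookup f a) (lookup f b)) fs →
    AllPairs (EdgeDisjoint H) fs →
    ∃[ es ] (Unique es × ∑ fs (𝟙 ∘ hit) ≤ ∑ es χ′ × All (EdgeOf fs) es)
  choose []       []       []       = [] , [] , z≤n , []
  choose (f ∷ fs) (w ∷ ws) (d ∷ ds) with choose fs ws ds | hit f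
  ... | es , u , le , own | false = es , u , le , All.map (λ (g , g∈ , r) → g , there g∈ , r) own
  ... | es , u , le , own | true with w _
  ... | a , b , h , 1≤ =
    (lookup f a , lookup f b) ∷ es , All.map fresh own ∷ u , +-mono-≤ 1≤ le ,
    (f , here refl , a , b , h , refl) ∷ All.map (λ (g , g∈ , r) → g , there g∈ , r) own
    where
    fresh : ∀ {e} → EdgeOf fs e → (lookup f a , lookup f b) ≢ e
    fresh (g , g∈ , a′ , b′ , h′ , refl) eq =
      All.lookup d g∈ a b a′ b′ h h′ (cong proj₁ eq , cong proj₂ eq)
... | es , u , le , _ = ≤-trans le (≤-trans
  (∑-Unique-⊆ es (cartesianProduct (allFin n) (allFin n)) _ u
    (λ {e} _ → ∈-cartesianProduct⁺ (∈-allFin (proj₁ e)) (∈-allFin (proj₂ e))))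
  (≤-reflexive (∑-cartesianProduct (allFin n) (allFin n) _)))

-- Reachable sets around a fixed vertex

module Reach {n : ℕ} (G : SimpleGraph n) (m A : ℕ) (w : Fin n) where

  -- These are the sets R_j of the overview, with `m / (A * n)` for θn. As `m` will be the number of
  -- edge-disjoint copies, θ is at least ε divided by the constant `A`.
  reach : ℕ → Fin n → Bool
  reach zero    v = adj G v w
  reach (suc j) v = m ≤ᵇ A * n * ∑ (allFin n) λ u → edge G v u * 𝟙 (reach j u)

  -- An edge along which the reachability of N(w) within j steps is lost.
  lost : ℕ → Fin n → Fin n → ℕ
  lost j u v = 𝟙 (not (reach (suc j) v)) * (edge G v u * 𝟙 (reach j u))

  kept : ℕ → Fin n → Fin n → ℕ
  kept j u v = edge G u v * (𝟙 (reach j u) * 𝟙 (reach j v))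

  -- Every copy that meets the neighbourhood of `w` twice will contain a pair of positive weight.
  -- Only `k` levels of loss count, since the middle edge is `k` steps away from either neighbour.
  weight : ℕ → Fin n → Fin n → ℕ
  weight k u v = ∑ (upTo k) (λ j → lost j u v) + kept k u v

  module _ {v} (H : Graph v) (f : Vec (Fin n) v)
           (f-adj : ∀ a b → T (H a b) → T (adj G (lookup f a) (lookup f b))) where

    Weighted : ℕ → Set
    Weighted k = ∃₂ λ a b → T (H a b) × 1 ≤ weight k (lookup f a) (lookup f b)

    -- Reachability passes from each vertex of the walk to the next, until the first failure, which
    -- is a lost edge.
    reach-along : ∀ k {a d b} → Walk H a d b → d ≤ k → T (adj G (lookup f a) w) →
      Weighted k ⊎ T (reach d (lookup f b))
    reach-along k stop d≤k t = inj₂ t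
    reach-along k (_▸_ {d} {b} {c} p h) d≤k t with reach-along k p (<⇒≤ d≤k) t
    ... | inj₁ x = inj₁ x
    ... | inj₂ r with reach (suc d) (lookup f c) in eq
    ... | true  = inj₂ _
    ... | false = inj₁ (b , c , h , ≤-trans one (m≤m+n _ _))
      where
      one : 1 ≤ ∑ (upTo k) (λ j → lost j (lookup f b) (lookup f c))
      one = ≤-trans (≤-reflexive (sym val)) (∑-∈ (λ j → lost j (lookup f b) (lookup f c)) (∈-upTo⁺ d≤k))
        where
        val : lost d (lookup f b) (lookup f c) ≡ 1
        val rewrite eq | edge-sym G (lookup f c) (lookup f b) | T⇒𝟙 (f-adj b c h) | T⇒𝟙 r = refl

  hit-weighted : ∀ k (f : Vec (Fin n) (suc (2 * suc k))) → IsCopy (Cycle _) G f →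
    2 ≤ ∑ (allFin _) (λ a → edge G (lookup f a) w) →
    ∃₂ λ a b → T (Cycle _ a b) × 1 ≤ weight k (lookup f a) (lookup f b)
  hit-weighted k f copy hit
    with two-witnesses (λ a → adj G (lookup f a) w) (allFin _) (allFin⁺ _) hit
  ... | a , b , a≢b , ta , tb
    -- The length is `k + 1 + k`: the step from `c′` to `c` is the middle one, and the remainder `q`
    -- is traversed backwards from `b`.
    with splitWalk k (subst (λ l → Walk (Cycle (suc (2 * suc k))) a l b) (len k) (oddWalk k a b a≢b))
    where
    len : ∀ k → suc (2 * k) ≡ k + suc k
    len = solve-∀
  ... | c , (_▸_ {b = c′} p h) , q
    with reach-along (Cycle _) f (IsCopy⇒adj (Cycle _) G f copy) k p ≤-refl ta
       | reach-along (Cycle _) f (IsCopy⇒adj (Cycle _) G f copy) k (reverseWalk q) ≤-refl tb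
  ... | inj₁ x | _ = x
  ... | inj₂ _ | inj₁ x = x
  ... | inj₂ r | inj₂ s = c′ , c , h , ≤-trans (≤-reflexive (sym val)) (m≤n+m _ (∑ (upTo k) _))
    where
    val : kept k (lookup f c′) (lookup f c) ≡ 1
    val rewrite T⇒𝟙 (IsCopy⇒adj (Cycle _) G f copy c′ c h) | T⇒𝟙 r | T⇒𝟙 s = refl

  -- Pairs are lost only at a `v` outside `reach (suc j)`, and such a `v` has few neighbours in
  -- `reach j` by definition.
  ∑-lost-j : ∀ j v → A * n * ∑ (allFin n) (λ u → lost j u v) ≤ m
  ∑-lost-j j v rewrite ∑-*ˡ (allFin n) (𝟙 (not (reach (suc j) v))) (λ u → edge G v u * 𝟙 (reach j u))
    with reach (suc j) v in eq
  ... | true  = ≤-trans (≤-reflexive (*-zeroʳ (A * n))) z≤n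
  ... | false = ≤-trans (≤-reflexive (cong (A * n *_) (+-identityʳ _)))
        (<⇒≤ (≰⇒> λ le → subst T eq (≤⇒≤ᵇ le)))

  ∑-lost : ∀ k → A * n * ∑ (allFin n) (λ u → ∑ (allFin n) λ v → ∑ (upTo k) λ j → lost j u v) ≤ k * (n * m)
  ∑-lost k = begin
    A * n * ∑ V (λ u → ∑ V λ v → ∑ (upTo k) λ j → lost j u v)
      ≡⟨ cong (A * n *_) reorder ⟩
    A * n * ∑ (upTo k) (λ j → ∑ V λ v → ∑ V λ u → lost j u v)
      ≡⟨ trans (sym (∑-*ˡ (upTo k) (A * n) _)) (∑-cong (upTo k) λ j → sym (∑-*ˡ V (A * n) _)) ⟩
    ∑ (upTo k) (λ j → ∑ V λ v → A * n * ∑ V λ u → lost j u v)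
      ≤⟨ ∑-mono (upTo k) (λ j → ∑-mono V λ v → ∑-lost-j j v) ⟩
    ∑ (upTo k) (λ j → ∑ V λ v → m)
      ≡⟨ trans (∑-cong (upTo k) λ j → ∑-allFin-const n m) (trans (∑-const (upTo k) _) (cong (_* (n * m)) (length-upTo k))) ⟩
    k * (n * m) ∎
    where
    open ≤-Reasoning
    V = allFin n
    reorder : ∑ V (λ u → ∑ V λ v → ∑ (upTo k) λ j → lost j u v)
            ≡ ∑ (upTo k) (λ j → ∑ V λ v → ∑ V λ u → lost j u v)
    reorder = trans (∑-cong V λ u → ∑-comm V (upTo k) _)
      (trans (∑-comm V (upTo k) _) (∑-cong (upTo k) λ j → ∑-comm V V _))

  -- Each of the `j` levels offers at least `m / (A * n)` continuations into the level below; the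
  -- factors `A * n` are the cleared denominators.
  reach⇒walks : ∀ j v → 𝟙 (reach j v) * m ^ j ≤ (A * n) ^ j * walks G j v w
  reach⇒walks zero    v = ≤-reflexive (trans (*-identityʳ _) (sym (+-identityʳ _)))
  reach⇒walks (suc j) v with reach (suc j) v in eq
  ... | false = z≤n
  ... | true  = begin
    1 * (m * m ^ j)                                                  ≡⟨ *-identityˡ _ ⟩
    m * m ^ j                                                        ≤⟨ *-monoˡ-≤ (m ^ j) (≤ᵇ⇒≤ m _ (Equivalence.from T-≡ eq)) ⟩
    A * n * ∑ V (λ u → edge G v u * 𝟙 (reach j u)) * m ^ j           ≡⟨ *-assoc (A * n) _ _ ⟩
    A * n * (∑ V (λ u → edge G v u * 𝟙 (reach j u)) * m ^ j)         ≡⟨ cong (A * n *_) (sym (∑-*ʳ V (m ^ j) _)) ⟩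
    A * n * ∑ V (λ u → edge G v u * 𝟙 (reach j u) * m ^ j)
      ≤⟨ *-monoʳ-≤ (A * n) (∑-mono V λ u → ≤-trans (≤-reflexive (*-assoc (edge G v u) _ _))
           (*-monoʳ-≤ (edge G v u) (reach⇒walks j u))) ⟩
    A * n * ∑ V (λ u → edge G v u * ((A * n) ^ j * walks G j u w))
      ≡⟨ cong (A * n *_) (trans (∑-cong V λ u → swap (edge G v u) ((A * n) ^ j) _) (∑-*ˡ V ((A * n) ^ j) _)) ⟩
    A * n * ((A * n) ^ j * walks G (suc j) v w)                      ≡⟨ sym (*-assoc (A * n) _ _) ⟩
    (A * n) ^ suc j * walks G (suc j) v w                            ∎
    where
    open ≤-Reasoning
    V = allFin n
    swap : ∀ a b c → a * (b * c) ≡ b * (a * c)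
    swap = solve-∀

  ∑-kept : ∀ k → ∑ (allFin n) (λ u → ∑ (allFin n) (kept k u)) * (m ^ k * m ^ k)
         ≤ (A * n) ^ k * (A * n) ^ k * walks G (2 * suc k) w w
  ∑-kept k = begin
    ∑ V (λ u → ∑ V (kept k u)) * (m ^ k * m ^ k)
      ≡⟨ trans (sym (∑-*ʳ V (m ^ k * m ^ k) _)) (∑-cong V λ u → sym (∑-*ʳ V (m ^ k * m ^ k) _)) ⟩
    ∑ V (λ u → ∑ V λ v → kept k u v * (m ^ k * m ^ k))
      ≤⟨ ∑-mono V (λ u → ∑-mono V λ v → pointwise u v) ⟩
    ∑ V (λ u → ∑ V λ v → (A * n) ^ k * (A * n) ^ k * (edge G u v * (walks G k u w * walks G k v w)))
      ≡⟨ trans (∑-cong V λ u → ∑-*ˡ V ((A * n) ^ k * (A * n) ^ k) _) (∑-*ˡ V ((A * n) ^ k * (A * n) ^ k) _) ⟩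
    (A * n) ^ k * (A * n) ^ k * ∑ V (λ u → ∑ V λ v → edge G u v * (walks G k u w * walks G k v w))
      ≡⟨ cong ((A * n) ^ k * (A * n) ^ k *_) (walks-through-middle G k w) ⟩
    (A * n) ^ k * (A * n) ^ k * walks G (2 * suc k) w w ∎
    where
    open ≤-Reasoning
    V = allFin n
    arith₁ : ∀ e r s x → e * (r * s) * (x * x) ≡ e * ((r * x) * (s * x))
    arith₁ = solve-∀
    arith₂ : ∀ e y p q → e * ((y * p) * (y * q)) ≡ y * y * (e * (p * q))
    arith₂ = solve-∀
    pointwise : ∀ u v → kept k u v * (m ^ k * m ^ k)
      ≤ (A * n) ^ k * (A * n) ^ k * (edge G u v * (walks G k u w * walks G k v w))
    pointwise u v = ≤-trans (≤-reflexive (arith₁ (edge G u v) (𝟙 (reach k u)) (𝟙 (reach k v)) (m ^ k)))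
      (≤-trans (*-monoʳ-≤ (edge G u v) (*-mono-≤ (reach⇒walks k u) (reach⇒walks k v)))
        (≤-reflexive (arith₂ (edge G u v) ((A * n) ^ k) (walks G k u w) (walks G k v w))))

-- Double counting of vertices and the copies that they hit

module _ {n : ℕ} (G : SimpleGraph n) where

  hitᵇ : ∀ {v} → Fin n → Vec (Fin n) v → Bool
  hitᵇ {v} w f = 2 ≤ᵇ ∑ (allFin v) (λ a → edge G (lookup f a) w)

  -- The degrees along f add up to more than (1 + 1/D) n.
  many-hits : ∀ {v} D P → suc D ≤ v * P → (∀ i → P * n ≤ D * degree G i) →
    (f : Vec (Fin n) v) → n ≤ D * v * ∑ (allFin n) (λ w → 𝟙 (hitᵇ w f))
  many-hits {v} D P D<vP deg f = +-cancelʳ-≤ (D * n) _ _ (begin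
    n + D * n                                   ≤⟨ *-monoˡ-≤ n D<vP ⟩
    v * P * n                                   ≡⟨ *-assoc v P n ⟩
    v * (P * n)                                 ≡⟨ sym (∑-allFin-const v (P * n)) ⟩
    ∑ (allFin v) (λ _ → P * n)                  ≤⟨ ∑-mono (allFin v) (λ a → deg (lookup f a)) ⟩
    ∑ (allFin v) (λ a → D * degree G (lookup f a)) ≡⟨ ∑-*ˡ (allFin v) D _ ⟩
    D * ∑ (allFin v) (λ a → degree G (lookup f a)) ≡⟨ cong (D *_) (∑-comm (allFin v) (allFin n) _) ⟩
    D * ∑ (allFin n) c                          ≤⟨ *-monoʳ-≤ D (∑-mono (allFin n) c≤) ⟩
    D * ∑ (allFin n) (λ w → 1 + v * 𝟙 (hitᵇ w f))
      ≡⟨ cong (D *_) (trans (∑-+ (allFin n) (λ _ → 1) _) (cong₂ _+_ (trans (∑-allFin-const n 1) (*-identityʳ n)) (∑-*ˡ (allFin n) v _))) ⟩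
    D * (n + v * h)                             ≡⟨ arith D n v h ⟩
    D * v * h + D * n                           ∎)
    where
    open ≤-Reasoning
    h = ∑ (allFin n) (λ w → 𝟙 (hitᵇ w f))
    arith : ∀ D n v h → D * (n + v * h) ≡ D * v * h + D * n
    arith = solve-∀
    c : Fin n → ℕ
    c w = ∑ (allFin v) (λ a → edge G (lookup f a) w)
    c≤v : ∀ w → c w ≤ v
    c≤v w = ≤-trans (∑-mono (allFin v) (λ a → 𝟙≤1 _)) (≤-reflexive (trans (∑-allFin-const v 1) (*-identityʳ v)))
    -- One incidence per vertex accounts for the `n` that the degree sum exceeds; beyond that only
    -- hit vertices contribute, each at most `v`.
    c≤ : ∀ w → c w ≤ 1 + v * 𝟙 (hitᵇ w f)
    c≤ w with hitᵇ w f in eq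
    ... | true  = ≤-trans (c≤v w) (≤-trans (≤-reflexive (sym (*-identityʳ v))) (n≤1+n _))
    ... | false = ≤-trans (≤-pred (≰⇒> λ le → subst T eq (≤⇒≤ᵇ le))) (m≤m+n 1 _)

  -- By `many-hits` there are at least `m * n / C` pairs of a vertex and a copy that it hits. The
  -- constant `Θ` is chosen so that lost edges account for at most half of these; the other half
  -- gives kept edges, each completed to closed walks by `∑-kept`.
  many-closed-walks : ∀ k D P → .{{_ : NonZero n}} → suc D ≤ suc (2 * suc k) * P →
    (∀ i → P * n ≤ D * degree G i) → ∀ fs →
    All (IsCopy (Cycle (suc (2 * suc k))) G) fs → AllPairs (EdgeDisjoint (Cycle (suc (2 * suc k)))) fs →
    let C = D * suc (2 * suc k) ; Θ = 2 * C * suc k ; m = length fs in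
    m * n * (m ^ k * m ^ k)
      ≤ 2 * C * ((Θ * n) ^ k * (Θ * n) ^ k * ∑ (allFin n) (λ w → walks G (2 * suc k) w w))
  many-closed-walks k D P D<LP deg fs copies disjoint = begin
    m * n * (m ^ k * m ^ k)
      ≤⟨ *-monoˡ-≤ (m ^ k * m ^ k) enough-kept ⟩
    2 * C * ∑ V Kept * (m ^ k * m ^ k)
      ≡⟨ trans (*-assoc (2 * C) _ _) (cong (2 * C *_) (sym (∑-*ʳ V (m ^ k * m ^ k) Kept))) ⟩
    2 * C * ∑ V (λ w → Kept w * (m ^ k * m ^ k))
      ≤⟨ *-monoʳ-≤ (2 * C) (∑-mono V (λ w → ∑-kept w k)) ⟩
    2 * C * ∑ V (λ w → (Θ * n) ^ k * (Θ * n) ^ k * walks G (2 * suc k) w w)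
      ≡⟨ cong (2 * C *_) (∑-*ˡ V ((Θ * n) ^ k * (Θ * n) ^ k) _) ⟩
    2 * C * ((Θ * n) ^ k * (Θ * n) ^ k * ∑ V (λ w → walks G (2 * suc k) w w)) ∎
    where
    open ≤-Reasoning
    L = suc (2 * suc k)
    C = D * L
    Θ = 2 * C * suc k
    m = length fs
    V = allFin n
    open Reach G m Θ
    Kept : Fin n → ℕ
    Kept w = ∑ V (λ u → ∑ V (kept w k u))
    Lost : Fin n → ℕ
    Lost w = ∑ V (λ u → ∑ V (λ v → ∑ (upTo k) (λ j → lost w j u v)))
    -- The factor `suc k` in `Θ` absorbs the `k` levels of loss, and unlike `k` it can be cancelled
    -- for triangles too.
    few-lost : ∀ w → 2 * C * Lost w ≤ m
    few-lost w = *-cancelˡ-≤ (suc k * n) {{m*n≢0 (suc k) n}} (begin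
      suc k * n * (2 * C * Lost w)   ≡⟨ arith (suc k) n (2 * C) (Lost w) ⟩
      Θ * n * Lost w                 ≤⟨ ∑-lost w k ⟩
      k * (n * m)                    ≤⟨ *-monoˡ-≤ (n * m) (n≤1+n k) ⟩
      suc k * (n * m)                ≡⟨ sym (*-assoc (suc k) n m) ⟩
      suc k * n * m                  ∎)
      where
      arith : ∀ s n c l → s * n * (c * l) ≡ c * s * n * l
      arith = solve-∀
    hits≤ : ∀ w → 2 * C * ∑ fs (λ f → 𝟙 (hitᵇ w f)) ≤ m + 2 * C * Kept w
    hits≤ w = begin
      2 * C * ∑ fs (λ f → 𝟙 (hitᵇ w f))
        ≤⟨ *-monoʳ-≤ (2 * C) (∑-EdgeDisjoint (Cycle L) (weight w k) (hitᵇ w) fs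
             (All.map (λ {f} cp t → hit-weighted w k f cp (≤ᵇ⇒≤ 2 _ t)) copies) disjoint) ⟩
      2 * C * ∑ V (λ u → ∑ V (weight w k u))
        ≡⟨ cong (2 * C *_) (trans (∑-cong V (λ u → ∑-+ V _ _)) (∑-+ V _ _)) ⟩
      2 * C * (Lost w + Kept w)
        ≡⟨ *-distribˡ-+ (2 * C) (Lost w) (Kept w) ⟩
      2 * C * Lost w + 2 * C * Kept w
        ≤⟨ +-monoˡ-≤ _ (few-lost w) ⟩
      m + 2 * C * Kept w ∎
    enough-kept : m * n ≤ 2 * C * ∑ V Kept
    enough-kept = +-cancelˡ-≤ (m * n) _ _ (begin
      m * n + m * n       ≡⟨ arith₁ (m * n) ⟩
      2 * (m * n)         ≡⟨ cong (2 *_) (sym (∑-const fs n)) ⟩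
      2 * ∑ fs (λ _ → n)  ≤⟨ *-monoʳ-≤ 2 (∑-mono fs (many-hits D P D<LP deg)) ⟩
      2 * ∑ fs (λ f → C * ∑ V (λ w → 𝟙 (hitᵇ w f)))
        ≡⟨ cong (2 *_) (trans (∑-*ˡ fs C _) (cong (C *_) (∑-comm fs V _))) ⟩
      2 * (C * ∑ V (λ w → ∑ fs (λ f → 𝟙 (hitᵇ w f))))
        ≡⟨ trans (sym (*-assoc 2 C _)) (sym (∑-*ˡ V (2 * C) _)) ⟩
      ∑ V (λ w → 2 * C * ∑ fs (λ f → 𝟙 (hitᵇ w f)))
        ≤⟨ ∑-mono V hits≤ ⟩
      ∑ V (λ w → m + 2 * C * Kept w)
        ≡⟨ trans (∑-+ V (λ _ → m) _) (cong₂ _+_ (∑-allFin-const n m) (∑-*ˡ V (2 * C) Kept)) ⟩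
      n * m + 2 * C * ∑ V Kept
        ≡⟨ cong (_+ 2 * C * ∑ V Kept) (*-comm n m) ⟩
      m * n + 2 * C * ∑ V Kept ∎)
      where
      arith₁ : ∀ x → x + x ≡ 2 * x
      arith₁ = solve-∀

  copies≤n² : ∀ k (fs : List (Vec (Fin n) _)) → AllPairs (EdgeDisjoint (Cycle (suc (2 * suc k)))) fs → length fs ≤ n * n
  copies≤n² k fs disjoint = begin
    length fs                              ≡⟨ sym (trans (∑-const fs 1) (*-identityʳ _)) ⟩
    ∑ fs (λ _ → 1)                         ≤⟨ ∑-EdgeDisjoint (Cycle _) (λ _ _ → 1) (λ _ → true) fs
                                                (All.universal (λ f _ → zero , suc zero , _ , ≤-refl) fs) disjoint ⟩
    ∑ (allFin n) (λ _ → ∑ (allFin n) (λ _ → 1)) ≡⟨ trans (∑-cong (allFin n) λ _ → trans (∑-allFin-const n 1) (*-identityʳ n)) (∑-allFin-const n n) ⟩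
    n * n                                  ∎
    where open ≤-Reasoning

∈-allMaps : ∀ {n v} (f : Vec (Fin n) v) → f ∈ allMaps n v
∈-allMaps []      = here refl
∈-allMaps {n} (x ∷ f) = ∈-concatMap⁺ (λ x → map (x ∷_) (allMaps n _)) {xs = allFin n}
  (Any.map (λ { refl → ∈-map⁺ (x ∷_) (∈-allMaps f) }) (∈-allFin x))

copyCount-positive : ∀ {v n} (H : Graph v) (G : SimpleGraph n) f → IsCopy H G f → 1 ≤ copyCount H G
copyCount-positive {v} {n} H G f c = begin
  1                                      ≡⟨ sym (T⇒𝟙 c) ⟩
  𝟙 (isCopyᵇ H G f)                      ≤⟨ ∑-∈ (𝟙 ∘ isCopyᵇ H G) (∈-allMaps f) ⟩
  ∑ (allMaps n v) (𝟙 ∘ isCopyᵇ H G)      ≡⟨ sym (length-filterᵇ _ (allMaps n v)) ⟩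
  copyCount H G                          ∎
  where open ≤-Reasoning

-- Either most closed walks are copies, or n is bounded in terms of x / y.
copies-dominate : ∀ l {x y n Q p N W H Z} → x ≤ y → x * n ≤ Q * (p * H) → H ≤ Z + W * N →
  p * N ≡ y → n ^ suc l ≡ n * N → 1 ≤ Z →
  x ^ suc l * n ^ suc l ≤ (2 * Q + (2 * Q * W) ^ suc l) * Z * y ^ suc l
copies-dominate l {x} {y} {n} {Q} {p} {N} {W} {H} {Z} x≤y walks≤ H≤ pN≡y n^≡ 1≤Z with ≤-total (W * N) Z
... | inj₁ WN≤Z = begin
    x ^ suc l * n ^ suc l          ≡⟨ cong (x ^ suc l *_) n^≡ ⟩
    x * x ^ l * (n * N)            ≡⟨ arith₁ x (x ^ l) n N ⟩
    x ^ l * (x * n * N)            ≤⟨ *-mono-≤ (^-monoˡ-≤ l x≤y) (*-monoˡ-≤ N walks≤) ⟩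
    y ^ l * (Q * (p * H) * N)      ≤⟨ *-monoʳ-≤ (y ^ l) (*-monoˡ-≤ N (*-monoʳ-≤ Q (*-monoʳ-≤ p H≤2Z))) ⟩
    y ^ l * (Q * (p * (2 * Z)) * N) ≡⟨ arith₂ (y ^ l) Q p Z N ⟩
    2 * Q * Z * (p * N * y ^ l)    ≡⟨ cong (λ t → 2 * Q * Z * (t * y ^ l)) pN≡y ⟩
    2 * Q * Z * y ^ suc l          ≤⟨ *-monoˡ-≤ (y ^ suc l) (*-monoˡ-≤ Z (m≤m+n (2 * Q) _)) ⟩
    (2 * Q + (2 * Q * W) ^ suc l) * Z * y ^ suc l ∎
  where
  open ≤-Reasoning
  arith₁ : ∀ x s n N → x * s * (n * N) ≡ s * (x * n * N)
  arith₁ = solve-∀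
  arith₂ : ∀ s Q p Z N → s * (Q * (p * (2 * Z)) * N) ≡ 2 * Q * Z * (p * N * s)
  arith₂ = solve-∀
  H≤2Z : H ≤ 2 * Z
  H≤2Z = ≤-trans H≤ (+-monoʳ-≤ Z (≤-trans WN≤Z (≤-reflexive (sym (+-identityʳ Z)))))
-- Here `n` is at most a constant times `y / x`, so the single copy granted by `1 ≤ Z` is enough.
... | inj₂ Z≤WN = begin
    x ^ suc l * n ^ suc l          ≡⟨ sym (^-distribʳ-* (suc l) x n) ⟩
    (x * n) ^ suc l                ≤⟨ ^-monoˡ-≤ (suc l) xn≤ ⟩
    (2 * Q * W * y) ^ suc l        ≡⟨ ^-distribʳ-* (suc l) (2 * Q * W) y ⟩
    (2 * Q * W) ^ suc l * y ^ suc l ≤⟨ *-monoˡ-≤ (y ^ suc l) (≤-trans (m≤n+m _ (2 * Q))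
                                         (m≤m*n _ Z {{>-nonZero 1≤Z}})) ⟩
    (2 * Q + (2 * Q * W) ^ suc l) * Z * y ^ suc l ∎
  where
  open ≤-Reasoning
  arith : ∀ Q p W N → Q * (p * (W * N + W * N)) ≡ 2 * Q * W * (p * N)
  arith = solve-∀
  xn≤ : x * n ≤ 2 * Q * W * y
  xn≤ = begin
    x * n                        ≤⟨ walks≤ ⟩
    Q * (p * H)                  ≤⟨ *-monoʳ-≤ Q (*-monoʳ-≤ p (≤-trans H≤ (+-monoˡ-≤ (W * N) Z≤WN))) ⟩
    Q * (p * (W * N + W * N))    ≡⟨ arith Q p W N ⟩
    2 * Q * W * (p * N)          ≡⟨ cong (2 * Q * W *_) pN≡y ⟩
    2 * Q * W * y                ∎

-- With `m` for `length fs` and `ε = m / (n * n)` this bounds the number of copies below by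
-- `ε ^ a * n ^ L / Q`. In `a`, the factor `L - 2` comes from `many-closed-walks`, and the factor
-- `L` from the case of small `n` in `copies-dominate`.
many-copies : ∀ k D P → ∃[ Q ] (∀ n (G : SimpleGraph n) → .{{NonZero n}} →
  suc D ≤ suc (2 * suc k) * P → (∀ i → P * n ≤ D * degree G i) → ∀ fs →
  All (IsCopy (Cycle (suc (2 * suc k))) G) fs → AllPairs (EdgeDisjoint (Cycle (suc (2 * suc k)))) fs →
  let L = suc (2 * suc k) ; a = suc (2 * k) * L in
  length fs ^ a * n ^ L ≤ Q * copyCount (Cycle L) G * (n * n) ^ a)
many-copies k D P = 2 * Q₀ + (2 * Q₀ * (L * L)) ^ L , λ where
    -- Without copies the left side is zero; otherwise the head of the list witnesses that some copy
    -- exists.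
    n G D<LP deg []           _                 _        → z≤n
    n G D<LP deg fs@(f ∷ _) copies@(c ∷ _) disjoint →
      let m = length fs
          H = ∑ (allFin n) (λ w → walks G (2 * suc k) w w)
          p = n ^ k * n ^ k
          Z = copyCount (Cycle L) G
          walks≤ : m ^ e * n ≤ Q₀ * (p * H)
          walks≤ = ≤-trans (≤-reflexive (m^e*n m n)) (≤-trans (many-closed-walks G k D P D<LP deg fs copies disjoint)
            (≤-reflexive (constant n H)))
      in subst₂ _≤_ (cong (_* n ^ L) (^-*-assoc m e L))
           (cong ((2 * Q₀ + (2 * Q₀ * (L * L)) ^ L) * Z *_) (^-*-assoc (n * n) e L))
           (copies-dominate (2 * suc k) {Q = Q₀} {p} {n ^ (2 * suc k)} {L * L} (^-monoˡ-≤ e (copies≤n² G k fs disjoint)) walks≤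
             (≤-trans (closed≤copies+coincidences G (2 * suc k)) (≤-reflexive (cong (Z +_) (sym (*-assoc L L (n ^ (2 * suc k)))))))
             (powers n) refl (copyCount-positive (Cycle L) G f c))
  where
  L = suc (2 * suc k)
  e = suc (2 * k)
  C = D * L
  Θ = 2 * C * suc k
  Q₀ = 2 * C * (Θ ^ k * Θ ^ k)
  double : ∀ x → x ^ (2 * k) ≡ x ^ k * x ^ k
  double x = trans (cong (λ i → x ^ (k + i)) (+-identityʳ k)) (^-distribˡ-+-* x k k)
  m^e*n : ∀ m n → m ^ e * n ≡ m * n * (m ^ k * m ^ k)
  m^e*n m n = trans (cong (λ t → m * t * n) (double m)) (swap m n (m ^ k * m ^ k))
    where
    swap : ∀ m n s → m * s * n ≡ m * n * s
    swap = solve-∀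
  constant : ∀ n H → 2 * C * ((Θ * n) ^ k * (Θ * n) ^ k * H) ≡ Q₀ * (n ^ k * n ^ k * H)
  constant n H = trans (cong (λ t → 2 * C * (t * t * H)) (^-distribʳ-* k Θ n)) (arith (2 * C) (Θ ^ k) (n ^ k) H)
    where
    arith : ∀ c a n h → c * ((a * n) * (a * n) * h) ≡ c * (a * a) * (n * n * h)
    arith = solve-∀
  powers : ∀ n → n ^ k * n ^ k * n ^ (2 * suc k) ≡ (n * n) ^ e
  powers n = begin
    n ^ k * n ^ k * n ^ (2 * suc k)           ≡⟨ cong (λ i → n ^ k * n ^ k * n ^ i) (*-suc 2 k) ⟩
    n ^ k * n ^ k * (n * (n * n ^ (2 * k)))   ≡⟨ cong (λ t → n ^ k * n ^ k * (n * (n * t))) (double n) ⟩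
    n ^ k * n ^ k * (n * (n * (n ^ k * n ^ k))) ≡⟨ arith n (n ^ k) ⟩
    n * n * (n ^ k * n ^ k * (n ^ k * n ^ k)) ≡⟨ cong (λ t → n * n * (t * t)) (sym (^-distribʳ-* k n n)) ⟩
    n * n * ((n * n) ^ k * (n * n) ^ k)       ≡⟨ cong (n * n *_) (sym (double (n * n))) ⟩
    (n * n) ^ e                               ∎
    where
    open ≡-Reasoning
    arith : ∀ n s → s * s * (n * (n * (s * s))) ≡ n * n * (s * s * (s * s))
    arith = solve-∀

-- Behrend-type sets

quot-<⇒< : ∀ B x x′ {y y′} → x < B → y < y′ → x + B * y < x′ + B * y′
quot-<⇒< B x x′ {y} {y′} x<B y<y′ = begin-strict
  x + B * y      <⟨ +-monoˡ-< (B * y) x<B ⟩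
  B + B * y      ≡⟨ sym (*-suc B y) ⟩
  B * suc y      ≤⟨ *-monoʳ-≤ B y<y′ ⟩
  B * y′         ≤⟨ m≤n+m _ x′ ⟩
  x′ + B * y′    ∎
  where open ≤-Reasoning

quot-rem-unique : ∀ B {x y x′ y′} → x < B → x′ < B → x + B * y ≡ x′ + B * y′ → x ≡ x′ × y ≡ y′
quot-rem-unique B {x} {y} {x′} {y′} x<B x′<B e with <-cmp y y′
... | tri≈ _ refl _ = +-cancelʳ-≡ (B * y) x x′ e , refl
... | tri< y<y′ _ _ = contradiction e (<⇒≢ (quot-<⇒< B x x′ x<B y<y′))
... | tri> _ _ y′<y = contradiction (sym e) (<⇒≢ (quot-<⇒< B x′ x x′<B y′<y))

square-expand : ∀ h u → h * h + u * u ≡ 2 * u * h + ∣ h - u ∣ * ∣ h - u ∣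
square-expand h u with ≤-total h u
... | inj₂ u≤h = trans (cong (λ h → h * h + u * u) (sym (m+[n∸m]≡n u≤h)))
    (trans (arith u (h ∸ u)) (cong₂ (λ a b → 2 * u * a + b * b) (m+[n∸m]≡n u≤h) (sym (trans (∣-∣-comm h u) (m≤n⇒∣m-n∣≡n∸m u≤h)))))
  where
  arith : ∀ u e → (u + e) * (u + e) + u * u ≡ 2 * u * (u + e) + e * e
  arith = solve-∀
... | inj₁ h≤u = trans (cong (λ u → h * h + u * u) (sym (m+[n∸m]≡n h≤u)))
    (trans (arith h (u ∸ h)) (cong₂ (λ a b → 2 * a * h + b * b) (m+[n∸m]≡n h≤u) (sym (m≤n⇒∣m-n∣≡n∸m h≤u))))
  where
  arith : ∀ h e → h * h + (h + e) * (h + e) ≡ 2 * (h + e) * h + e * e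
  arith = solve-∀

-- This is the variance identity: the mixed terms cancel because `u` is the mean of `h`.
∑-squares : ∀ {A : Set} (xs : List A) (h : A → ℕ) u → ∑ xs h ≡ length xs * u →
  ∑ xs (λ x → h x * h x) ≡ length xs * (u * u) + ∑ xs (λ x → ∣ h x - u ∣ * ∣ h x - u ∣)
∑-squares xs h u e = +-cancelʳ-≡ (n * (u * u)) _ _ (begin
  ∑ xs (λ x → h x * h x) + n * (u * u)
    ≡⟨ cong (∑ xs (λ x → h x * h x) +_) (sym (∑-const xs (u * u))) ⟩
  ∑ xs (λ x → h x * h x) + ∑ xs (λ _ → u * u)
    ≡⟨ sym (∑-+ xs _ _) ⟩
  ∑ xs (λ x → h x * h x + u * u)
    ≡⟨ trans (∑-cong xs (λ x → square-expand (h x) u)) (∑-+ xs _ _) ⟩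
  ∑ xs (λ x → 2 * u * h x) + D
    ≡⟨ cong (_+ D) (trans (∑-*ˡ xs (2 * u) h) (cong (2 * u *_) e)) ⟩
  2 * u * (n * u) + D
    ≡⟨ arith n u D ⟩
  n * (u * u) + D + n * (u * u) ∎)
  where
  open ≡-Reasoning
  n = length xs
  D = ∑ xs (λ x → ∣ h x - u ∣ * ∣ h x - u ∣)
  arith : ∀ n u D → 2 * u * (n * u) + D ≡ n * (u * u) + D + n * (u * u)
  arith = solve-∀

module Behrend (L d : ℕ) .{{_ : NonZero L}} where

  base = L * d

  -- The digits are below `d` but the base is `L * d`, so fewer than `L` codes are added without a
  -- carry. `norm` is the squared Euclidean length.
  code norm : ∀ {r} → Vec (Fin d) r → ℕ
  code {zero}  s = 0
  code {suc r} s = toℕ (head s) + base * code (tail s)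
  norm {zero}  s = 0
  norm {suc r} s = toℕ (head s) * toℕ (head s) + norm (tail s)

  -- Behrend restricts to the vectors of one norm. Here the norm is written above the digits
  -- instead, which keeps all `d ^ r` vectors and enlarges the range by a factor of at most
  -- `suc (r * (d * d))`.
  val : ∀ {r} → Vec (Fin d) r → ℕ
  val {r} s = code s + base ^ r * norm s

  dist² : ∀ {r} → Vec (Fin d) r → Vec (Fin d) r → ℕ
  dist² {zero}  s u = 0
  dist² {suc r} s u =
    ∣ toℕ (head s) - toℕ (head u) ∣ * ∣ toℕ (head s) - toℕ (head u) ∣ + dist² (tail s) (tail u)

  dist²≡0 : ∀ {r} (s u : Vec (Fin d) r) → dist² s u ≡ 0 → s ≡ u
  dist²≡0 []      []      _ = refl
  dist²≡0 (x ∷ s) (y ∷ u) e = cong₂ _∷_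
    (toℕ-injective (∣m-n∣≡0⇒m≡n (m*m≡0 (m+n≡0⇒m≡0 _ e)))) (dist²≡0 s u (m+n≡0⇒n≡0 _ e))
    where
    m*m≡0 : ∀ {m} → m * m ≡ 0 → m ≡ 0
    m*m≡0 {zero} _ = refl

  -- The factor `L` leaves room for a sum of fewer than `L` codes to stay below the part of `val`
  -- that holds the norm.
  code-bound : ∀ {r} (s : Vec (Fin d) r) → L * code s < base ^ r
  code-bound {zero}  s = ≤-reflexive (cong suc (*-zeroʳ L))
  code-bound {suc r} s = begin-strict
    L * (toℕ (head s) + base * code (tail s))   ≡⟨ arith L (toℕ (head s)) base (code (tail s)) ⟩
    L * toℕ (head s) + base * (L * code (tail s)) <⟨ +-monoˡ-< _ (*-monoʳ-< L (toℕ<n (head s))) ⟩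
    base + base * (L * code (tail s))           ≡⟨ sym (*-suc base _) ⟩
    base * suc (L * code (tail s))              ≤⟨ *-monoʳ-≤ base (code-bound (tail s)) ⟩
    base * base ^ r                             ∎
    where
    open ≤-Reasoning
    arith : ∀ L t b c → L * (t + b * c) ≡ L * t + b * (L * c)
    arith = solve-∀

  norm-bound : ∀ {r} (s : Vec (Fin d) r) → norm s ≤ r * (d * d)
  norm-bound {zero}  s = z≤n
  norm-bound {suc r} s = +-mono-≤ (*-mono-≤ (<⇒≤ (toℕ<n (head s))) (<⇒≤ (toℕ<n (head s)))) (norm-bound (tail s))

  val-bound : ∀ {r} (s : Vec (Fin d) r) → val s < suc (r * (d * d)) * base ^ r
  val-bound {r} s = begin-strict
    code s + base ^ r * norm s                <⟨ +-monoˡ-< _ (≤-<-trans (m≤n*m (code s) L) (code-bound s)) ⟩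
    base ^ r + base ^ r * norm s              ≤⟨ +-monoʳ-≤ (base ^ r) (*-monoʳ-≤ (base ^ r) (norm-bound s)) ⟩
    base ^ r + base ^ r * (r * (d * d))       ≡⟨ cong (base ^ r +_) (*-comm (base ^ r) _) ⟩
    suc (r * (d * d)) * base ^ r              ∎
    where open ≤-Reasoning

  -- Without carries the averaging hypothesis holds digit by digit, and the variance identity is
  -- summed over the digits.
  ∑-norm : ∀ {r} (ss : List (Vec (Fin d) r)) u → length ss < L → ∑ ss code ≡ length ss * code u →
    ∑ ss norm ≡ length ss * norm u + ∑ ss (λ s → dist² s u)
  ∑-norm {zero}  ss u lt e = sym (cong₂ _+_ (*-zeroʳ (length ss)) refl)
  ∑-norm {suc r} ss u lt e = begin
    ∑ ss norm
      ≡⟨ ∑-+ ss _ _ ⟩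
    ∑ ss (λ s → h s * h s) + ∑ ss (norm ∘ tail)
      ≡⟨ cong₂ _+_ (∑-squares ss h (h u) (proj₁ split)) tails ⟩
    n * (h u * h u) + D₁ + (n * norm (tail u) + D₂)
      ≡⟨ arith n (h u * h u) D₁ (norm (tail u)) D₂ ⟩
    n * norm u + (D₁ + D₂)
      ≡⟨ cong (n * norm u +_) (sym (∑-+ ss _ _)) ⟩
    n * norm u + ∑ ss (λ s → dist² s u) ∎
    where
    open ≡-Reasoning
    n = length ss
    h : Vec (Fin d) (suc r) → ℕ
    h s = toℕ (head s)
    D₁ = ∑ ss (λ s → ∣ h s - h u ∣ * ∣ h s - h u ∣)
    D₂ = ∑ ss (λ s → dist² (tail s) (tail u))
    arith : ∀ n a b c e → n * a + b + (n * c + e) ≡ n * (a + c) + (b + e)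
    arith = solve-∀
    d-pos : 0 < d
    d-pos = ≤-trans (s≤s z≤n) (toℕ<n (head u))
    n*d<base : n * d < base
    n*d<base = *-monoˡ-< d {{>-nonZero d-pos}} lt
    ∑h<base : ∑ ss h < base
    ∑h<base = ≤-<-trans (∑-mono ss (λ s → <⇒≤ (toℕ<n (head s)))) (subst (_< base) (sym (∑-const ss d)) n*d<base)
    split : ∑ ss h ≡ n * h u × ∑ ss (code ∘ tail) ≡ n * code (tail u)
    split = quot-rem-unique base ∑h<base (≤-<-trans (*-monoʳ-≤ n (<⇒≤ (toℕ<n (head u)))) n*d<base) (begin
      ∑ ss h + base * ∑ ss (code ∘ tail)            ≡⟨ cong (∑ ss h +_) (sym (∑-*ˡ ss base _)) ⟩
      ∑ ss h + ∑ ss (λ s → base * code (tail s))    ≡⟨ sym (∑-+ ss _ _) ⟩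
      ∑ ss code                                     ≡⟨ e ⟩
      n * (h u + base * code (tail u))              ≡⟨ dist n (h u) base (code (tail u)) ⟩
      n * h u + base * (n * code (tail u))          ∎)
      where
      dist : ∀ n h b c → n * (h + b * c) ≡ n * h + b * (n * c)
      dist = solve-∀
    tails : ∑ ss (norm ∘ tail) ≡ n * norm (tail u) + D₂
    tails = begin
      ∑ ss (norm ∘ tail)      ≡⟨ sym (∑-map tail ss norm) ⟩
      ∑ (map tail ss) norm    ≡⟨ ∑-norm (map tail ss) (tail u) (subst (_< L) (sym (length-map tail ss)) lt)
          (trans (∑-map tail ss code) (trans (proj₂ split) (cong (_* code (tail u)) (sym (length-map tail ss))))) ⟩
      length (map tail ss) * norm (tail u) + ∑ (map tail ss) (λ s → dist² s (tail u))
        ≡⟨ cong₂ _+_ (cong (_* norm (tail u)) (length-map tail ss)) (∑-map tail ss _) ⟩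
      n * norm (tail u) + D₂ ∎

  -- Points (s , |s|²) of a paraboloid: an average of fewer than L of them is again
  -- one of them only if they all coincide.
  val-average : ∀ {r} (ss : List (Vec (Fin d) r)) u → length ss < L → ∑ ss val ≡ length ss * val u →
    All (_≡ u) ss
  val-average {r} ss u lt e = All.tabulate λ {s} s∈ →
      dist²≡0 s u (n≤0⇒n≡0 (≤-trans (∑-∈ (λ s → dist² s u) s∈) (≤-reflexive zero-dist)))
    where
    open ≡-Reasoning
    n = length ss
    R = base ^ r
    ∑code<R : ∑ ss code < R
    ∑code<R = *-cancelˡ-< L _ _ (≤-<-trans (≤-reflexive (sym (∑-*ˡ ss L code)))
      (≤-<-trans (∑-mono ss (λ s → <⇒≤ (code-bound s)))
        (subst (_< L * R) (sym (∑-const ss R)) (*-monoˡ-< R {{>-nonZero (≤-trans (s≤s z≤n) (code-bound u))}} lt))))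
    split : ∑ ss code ≡ n * code u × ∑ ss norm ≡ n * norm u
    split = quot-rem-unique R ∑code<R (≤-<-trans (*-monoˡ-≤ (code u) (<⇒≤ lt)) (code-bound u)) (begin
      ∑ ss code + R * ∑ ss norm             ≡⟨ cong (∑ ss code +_) (sym (∑-*ˡ ss R norm)) ⟩
      ∑ ss code + ∑ ss (λ s → R * norm s)   ≡⟨ sym (∑-+ ss _ _) ⟩
      ∑ ss val                              ≡⟨ e ⟩
      n * (code u + R * norm u)             ≡⟨ dist n (code u) R (norm u) ⟩
      n * code u + R * (n * norm u)         ∎)
      where
      dist : ∀ n c R m → n * (c + R * m) ≡ n * c + R * (n * m)
      dist = solve-∀
    -- The norms average to that of `u` as well, which leaves nothing for the variance term.
    zero-dist : ∑ ss (λ s → dist² s u) ≡ 0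
    zero-dist = +-cancelˡ-≡ (n * norm u) _ _ (begin
      n * norm u + ∑ ss (λ s → dist² s u)   ≡⟨ sym (∑-norm ss u lt (proj₁ split)) ⟩
      ∑ ss norm                             ≡⟨ proj₂ split ⟩
      n * norm u                            ≡⟨ sym (+-identityʳ _) ⟩
      n * norm u + 0                        ∎)

-- The graph below the threshold

T-does⁺ : ∀ {P : Set} (d : Dec P) → P → T (does d)
T-does⁺ (yes _) _ = _
T-does⁺ (no ¬p) p = ¬p p

T-does⁻ : ∀ {P : Set} (d : Dec P) → T (does d) → P
T-does⁻ (yes p) _ = p

-- The layers V_i = Fin N and U_i = Fin M, for i : Fin L.
module Layered (k : ℕ) {S : Set} (labels : List S) (val : S → ℕ) (N M : ℕ) where

  K L : ℕ
  K = 2 * suc k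
  L = suc K

  Vertex : Set
  Vertex = Fin L × (Fin N ⊎ Fin M)

  layer side : Vertex → ℕ
  layer (i , _)      = toℕ i
  side (_ , inj₁ _)  = 0
  side (_ , inj₂ _)  = 1

  Next Wrap : Fin L → Fin L → Set
  Next i j = toℕ j ≡ suc (toℕ i)
  Wrap i j = toℕ j ≡ 0 × suc (toℕ i) ≡ L

  -- The edges are oriented so that a walk can be assigned a winding number; only the layers of
  -- integers have edges from the last layer to the first.
  Up Vertical : Vertex → Vertex → Set
  Up (i , inj₁ x) (j , inj₁ y) =
    (Next i j × Any.Any (λ s → toℕ y ≡ toℕ x + val s) labels) ⊎
    (Wrap i j × Any.Any (λ s → toℕ x ≡ toℕ y + K * val s) labels)
  Up (i , inj₂ x) (j , inj₂ y) = Next i j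
  Up _            _            = ⊥
  Vertical (i , inj₁ x) (j , inj₂ y) = toℕ i ≡ toℕ j
  Vertical _            _            = ⊥

  Up? : ∀ u v → Dec (Up u v)
  Up? (i , inj₁ x) (j , inj₁ y) =
    ((toℕ j ℕ.≟ suc (toℕ i)) ×-dec Any.any? (λ s → toℕ y ℕ.≟ toℕ x + val s) labels) ⊎-dec
    (((toℕ j ℕ.≟ 0) ×-dec (suc (toℕ i) ℕ.≟ L)) ×-dec Any.any? (λ s → toℕ x ℕ.≟ toℕ y + K * val s) labels)
  Up? (i , inj₁ x) (j , inj₂ y) = no λ ()
  Up? (i , inj₂ x) (j , inj₁ y) = no λ ()
  Up? (i , inj₂ x) (j , inj₂ y) = toℕ j ℕ.≟ suc (toℕ i)

  Vertical? : ∀ u v → Dec (Vertical u v)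
  Vertical? (i , inj₁ x) (j , inj₁ y) = no λ ()
  Vertical? (i , inj₁ x) (j , inj₂ y) = toℕ i ℕ.≟ toℕ j
  Vertical? (i , inj₂ x) (j , inj₁ y) = no λ ()
  Vertical? (i , inj₂ x) (j , inj₂ y) = no λ ()

  Adj : Vertex → Vertex → Set
  Adj u v = (Up u v ⊎ Up v u) ⊎ (Vertical u v ⊎ Vertical v u)

  Adj? : ∀ u v → Dec (Adj u v)
  Adj? u v = (Up? u v ⊎-dec Up? v u) ⊎-dec (Vertical? u v ⊎-dec Vertical? v u)

  Adj?-sym : ∀ u v → does (Adj? u v) ≡ does (Adj? v u)
  Adj?-sym u v = cong₂ _∨_ (∨-comm (does (Up? u v)) _) (∨-comm (does (Vertical? u v)) _)

  Adj-irrefl : ∀ u → ¬ Adj u u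
  Adj-irrefl (i , inj₁ x) (inj₁ (inj₁ p)) = Up-irrefl p
    where
    Up-irrefl : ¬ Up (i , inj₁ x) (i , inj₁ x)
    Up-irrefl (inj₁ (e , _))       = 1+n≢n (sym e)
    Up-irrefl (inj₂ ((e , f) , _)) = contradiction (trans (cong suc (sym e)) f) λ ()
  Adj-irrefl (i , inj₁ x) (inj₁ (inj₂ p)) = Adj-irrefl (i , inj₁ x) (inj₁ (inj₁ p))
  Adj-irrefl (i , inj₁ x) (inj₂ (inj₁ ()))
  Adj-irrefl (i , inj₁ x) (inj₂ (inj₂ ()))
  Adj-irrefl (i , inj₂ x) (inj₁ (inj₁ e)) = 1+n≢n (sym e)
  Adj-irrefl (i , inj₂ x) (inj₁ (inj₂ e)) = 1+n≢n (sym e)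
  Adj-irrefl (i , inj₂ x) (inj₂ (inj₁ ()))
  Adj-irrefl (i , inj₂ x) (inj₂ (inj₂ ()))

  -- An increase by one modulo `L`, with a multiple of `L` on each side in place of one integer.
  Up-layer : ∀ u v → Up u v → ∃₂ λ c c′ → suc (layer u) + c * L ≡ layer v + c′ * L
  Up-layer (i , inj₁ x) (j , inj₁ y) (inj₁ (e , _))       = 0 , 0 , cong (_+ 0) (sym e)
  Up-layer (i , inj₁ x) (j , inj₁ y) (inj₂ ((e , f) , _)) = 0 , 1 , (begin
    suc (toℕ i) + 0 ≡⟨ cong (_+ 0) f ⟩
    1 * L           ≡⟨ cong (_+ 1 * L) (sym e) ⟩
    toℕ j + 1 * L   ∎)
    where open ≡-Reasoning
  Up-layer (i , inj₂ x) (j , inj₂ y) e = 0 , 0 , cong (_+ 0) (sym e)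

  Up-side : ∀ u v → Up u v → side u ≡ side v
  Up-side (_ , inj₁ _) (_ , inj₁ _) _ = refl
  Up-side (_ , inj₂ _) (_ , inj₂ _) _ = refl

  Vertical-layer : ∀ u v → Vertical u v → layer u ≡ layer v
  Vertical-layer (_ , inj₁ _) (_ , inj₂ _) e = e

  Vertical-side : ∀ u v → Vertical u v → side u ≡ 0 × side v ≡ 1
  Vertical-side (_ , inj₁ _) (_ , inj₂ _) e = refl , refl

  module _ (z : ℕ → Vertex) where

    -- The first t steps of z consist of p steps up, m steps down and q vertical ones.
    record Steps (t : ℕ) : Set where
      field
        p m q c c′ e : ℕ
        total     : p + m + q ≡ t
        lift      : layer (z 0) + p + c * L ≡ layer (z t) + m + c′ * L
        parity-q  : side (z 0) + side (z t) + q ≡ 2 * e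
        -- The order of the steps is recorded only for monotone walks, the only ones that survive in
        -- `winds`.
        all-up    : p ≡ t → ∀ i → i < t → Up (z i) (z (suc i))
        all-down  : m ≡ t → ∀ i → i < t → Up (z (suc i)) (z i)

    countSteps : ∀ t → (∀ i → i < t → Adj (z i) (z (suc i))) → Steps t
    countSteps zero    h = record
      { p = 0 ; m = 0 ; q = 0 ; c = 0 ; c′ = 0 ; e = side (z 0) ; total = refl ; lift = refl
      ; parity-q = trans (+-identityʳ _) (cong (side (z 0) +_) (sym (+-identityʳ _)))
      ; all-up = λ _ i () ; all-down = λ _ i () }
    countSteps (suc t) h = extend (countSteps t (λ i i<t → h i (m<n⇒m<1+n i<t))) (h t ≤-refl)
      where
      extend-all : ∀ {P : ℕ → Set} → (∀ i → i < t → P i) → P t → ∀ i → i < suc t → P i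
      extend-all f pt i i<1+t with m≤n⇒m<n∨m≡n (≤-pred i<1+t)
      ... | inj₁ i<t  = f i i<t
      ... | inj₂ refl = pt
      too-small : ∀ {x y} → x ≤ t → x ≡ suc t → y
      too-small x≤t refl = ⊥-elim (1+n≰n x≤t)
      extend : Steps t → Adj (z t) (z (suc t)) → Steps (suc t)
      extend s (inj₁ (inj₁ up)) with Up-layer _ _ up
      ... | d , d′ , eq = record
        { p = suc p ; m = m ; q = q ; c = c + d ; c′ = c′ + d′ ; e = e
        ; total = cong suc total
        ; lift = lift′
        ; parity-q = trans (cong (λ x → side (z 0) + x + q) (sym (Up-side _ _ up))) parity-q
        ; all-up = λ e → extend-all (all-up (cong pred e)) up
        ; all-down = too-small (≤-trans (m≤n+m m p) (≤-trans (m≤m+n _ q) (≤-reflexive total)))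
        }
        where
        open Steps s
        lift′ : layer (z 0) + suc p + (c + d) * L ≡ layer (z (suc t)) + m + (c′ + d′) * L
        lift′ = trans (arith₁ (layer (z 0)) p c d L) (trans (cong (λ x → suc x + d * L) lift)
          (trans (arith₂ (layer (z t)) m c′ d L) (trans (cong (_+ (m + c′ * L)) eq) (arith₃ (layer (z (suc t))) m c′ d′ L))))
          where
          arith₁ : ∀ a p c d L → a + suc p + (c + d) * L ≡ suc (a + p + c * L) + d * L
          arith₁ = solve-∀
          arith₂ : ∀ b m c d L → suc (b + m + c * L) + d * L ≡ suc b + d * L + (m + c * L)
          arith₂ = solve-∀
          arith₃ : ∀ b m c d L → b + d * L + (m + c * L) ≡ b + m + (c + d) * L
          arith₃ = solve-∀
      extend s (inj₁ (inj₂ dn)) with Up-layer _ _ dn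
      ... | d , d′ , eq = record
        { p = p ; m = suc m ; q = q ; c = c + d′ ; c′ = c′ + d ; e = e
        ; total = trans (cong (_+ q) (+-suc p m)) (cong suc total)
        ; lift = lift′
        ; parity-q = trans (cong (λ x → side (z 0) + x + q) (Up-side _ _ dn)) parity-q
        ; all-up = too-small (≤-trans (m≤m+n p m) (≤-trans (m≤m+n _ q) (≤-reflexive total)))
        ; all-down = λ e → extend-all (all-down (cong pred e)) dn
        }
        where
        open Steps s
        lift′ : layer (z 0) + p + (c + d′) * L ≡ layer (z (suc t)) + suc m + (c′ + d) * L
        lift′ = trans (arith₁ (layer (z 0)) p c d′ L) (trans (cong (_+ d′ * L) lift)
          (trans (arith₂ (layer (z t)) m c′ d′ L) (trans (cong (_+ (m + c′ * L)) (sym eq)) (arith₃ (layer (z (suc t))) m c′ d L))))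
          where
          arith₁ : ∀ a p c d L → a + p + (c + d) * L ≡ (a + p + c * L) + d * L
          arith₁ = solve-∀
          arith₂ : ∀ b m c d L → (b + m + c * L) + d * L ≡ b + d * L + (m + c * L)
          arith₂ = solve-∀
          arith₃ : ∀ b m c d L → suc b + d * L + (m + c * L) ≡ b + suc m + (c + d) * L
          arith₃ = solve-∀
      extend s (inj₂ v) = record
        { p = p ; m = m ; q = suc q ; c = c ; c′ = c′ ; e = proj₁ (flip v)
        ; total = trans (+-suc (p + m) q) (cong suc total)
        ; lift = trans lift (cong (λ x → x + m + c′ * L) (same-layer v))
        ; parity-q = proj₂ (flip v)
        ; all-up = too-small (≤-trans (m≤m+n p m) (≤-trans (m≤m+n _ q) (≤-reflexive total)))
        ; all-down = too-small (≤-trans (m≤n+m m p) (≤-trans (m≤m+n _ q) (≤-reflexive total)))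
        }
        where
        open Steps s
        same-layer : Vertical (z t) (z (suc t)) ⊎ Vertical (z (suc t)) (z t) → layer (z t) ≡ layer (z (suc t))
        same-layer (inj₁ v) = Vertical-layer _ _ v
        same-layer (inj₂ v) = sym (Vertical-layer _ _ v)
        flip : Vertical (z t) (z (suc t)) ⊎ Vertical (z (suc t)) (z t) →
          ∃[ e′ ] (side (z 0) + side (z (suc t)) + suc q ≡ 2 * e′)
        flip (inj₁ v) with Vertical-side _ _ v
        ... | a , b = suc e , trans (cong (λ x → side (z 0) + x + suc q) b)
          (trans (arith (side (z 0)) q e) (trans (cong (λ x → 2 + x) (trans (cong (λ x → side (z 0) + x + q) (sym a)) parity-q)) (arith₂ e)))
          where
          arith : ∀ s q e → s + 1 + suc q ≡ 2 + (s + 0 + q)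
          arith = solve-∀
          arith₂ : ∀ e → 2 + 2 * e ≡ 2 * suc e
          arith₂ = solve-∀
        flip (inj₂ v) with Vertical-side _ _ v
        ... | a , b = e , trans (cong (λ x → side (z 0) + x + suc q) a)
          (trans (arith (side (z 0)) q) (trans (cong (λ x → side (z 0) + x + q) (sym b)) parity-q))
          where
          arith : ∀ s q → s + 0 + suc q ≡ s + 1 + q
          arith = solve-∀

    -- A closed walk of length L winds around the layers exactly once: its lift to ℤ
    -- moves by a multiple of L, by at most L, and by an odd number.
    winds : (∀ i → i < L → Adj (z i) (z (suc i))) → z L ≡ z 0 →
      (∀ i → i < L → Up (z i) (z (suc i))) ⊎ (∀ i → i < L → Up (z (suc i)) (z i))
    winds h closed = decide (countSteps L h)
      where
      displacement : (s : Steps L) → let open Steps s in p + c * L ≡ m + c′ * L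
      displacement s = +-cancelˡ-≡ (layer (z 0)) _ _ (trans (sym (+-assoc (layer (z 0)) p _))
        (trans lift (trans (cong (λ x → layer x + m + c′ * L) closed) (+-assoc (layer (z 0)) m _))))
        where open Steps s
      decide : Steps L → _
      decide s with <-cmp c c′
        where open Steps s
      ... | tri< c<c′ _ _ = inj₁ (all-up (≤-antisym p≤L L≤p))
        where
        open Steps s
        p≤L = ≤-trans (m≤m+n p m) (≤-trans (m≤m+n _ q) (≤-reflexive total))
        L≤p : L ≤ p
        L≤p = +-cancelʳ-≤ (c * L) L p (≤-trans (*-monoˡ-≤ L c<c′) (≤-trans (m≤n+m _ m) (≤-reflexive (sym (displacement s)))))
      ... | tri> _ _ c′<c = inj₂ (all-down (≤-antisym m≤L L≤m))
        where
        open Steps s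
        m≤L = ≤-trans (m≤n+m m p) (≤-trans (m≤m+n _ q) (≤-reflexive total))
        L≤m : L ≤ m
        L≤m = +-cancelʳ-≤ (c′ * L) L m (≤-trans (*-monoˡ-≤ L c′<c) (≤-trans (m≤n+m _ p) (≤-reflexive (displacement s))))
      -- Without net winding `p ≡ m`, and `q` is even because the walk returns to its side, so `L`
      -- would be even.
      ... | tri≈ _ c≡c′ _ = ⊥-elim (odd≢even (suc k + side (z 0)) (p + e) (begin
            suc (2 * (suc k + side (z 0)))    ≡⟨ arith₁ k (side (z 0)) ⟩
            L + (side (z 0) + side (z 0))     ≡⟨ cong (_+ (side (z 0) + side (z 0))) (sym total) ⟩
            p + m + q + (side (z 0) + side (z 0)) ≡⟨ arith₂ p m q (side (z 0)) ⟩
            p + m + (side (z 0) + side (z 0) + q) ≡⟨ cong₂ (λ a b → p + a + b) (sym p≡m) (trans (cong (λ x → side (z 0) + side x + q) (sym closed)) parity-q) ⟩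
            p + p + 2 * e                     ≡⟨ arith₃ p e ⟩
            2 * (p + e)                       ∎))
        where
        open Steps s
        open ≡-Reasoning
        p≡m : p ≡ m
        p≡m = +-cancelˡ-≡ (layer (z 0)) _ _ (+-cancelʳ-≡ (c * L) _ _
          (trans lift (cong₂ (λ x y → layer x + m + y * L) closed (sym c≡c′))))
        arith₁ : ∀ k s → suc (2 * (suc k + s)) ≡ suc (2 * suc k) + (s + s)
        arith₁ = solve-∀
        arith₂ : ∀ p m q s → p + m + q + (s + s) ≡ p + m + (s + s + q)
        arith₂ = solve-∀
        arith₃ : ∀ p e → p + p + 2 * e ≡ 2 * (p + e)
        arith₃ = solve-∀
        odd≢even : ∀ a b → suc (2 * a) ≢ 2 * b
        odd≢even zero    (suc b) eq = contradiction (trans eq (*-suc 2 b)) λ ()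
        odd≢even (suc a) (suc b) eq = odd≢even a b (suc-inj (suc-inj (trans (cong suc (sym (*-suc 2 a))) (trans eq (*-suc 2 b)))))
          where suc-inj = ℕ.suc-injective

  position : Vertex → ℕ
  position (_ , inj₁ x) = toℕ x
  position (_ , inj₂ x) = toℕ x

  data UpBy (s : S) : Vertex → Vertex → Set where
    next : ∀ {i j x y} → Next i j → toℕ y ≡ toℕ x + val s → UpBy s (i , inj₁ x) (j , inj₁ y)
    wrap : ∀ {i j x y} → Wrap i j → toℕ x ≡ toℕ y + K * val s → UpBy s (i , inj₁ x) (j , inj₁ y)

  UpBy-label : ∀ {s s′ u v} → UpBy s u v → UpBy s′ u v → val s ≡ val s′
  UpBy-label (next {x = x} _ e) (next _ e′) = +-cancelˡ-≡ (toℕ x) _ _ (trans (sym e) e′)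
  UpBy-label (next e _) (wrap (e′ , _) _)   = contradiction (trans (sym e) e′) λ ()
  UpBy-label (wrap (e′ , _) _) (next e _)   = contradiction (trans (sym e) e′) λ ()
  UpBy-label (wrap {y = y} _ e) (wrap _ e′) = *-cancelˡ-≡ _ _ K (+-cancelˡ-≡ (toℕ y) _ _ (trans (sym e) e′))

  private
    ≡-vertex : ∀ {i j : Fin L} {x y : Fin N} → toℕ i ≡ toℕ j → toℕ x ≡ toℕ y →
      _≡_ {A = Vertex} (i , inj₁ x) (j , inj₁ y)
    ≡-vertex p q = cong₂ (λ i x → i , inj₁ x) (toℕ-injective p) (toℕ-injective q)

    Next-Wrap : ∀ {i j j′} → Next i j → ¬ Wrap i j′
    Next-Wrap {j = j} e (_ , f) = <⇒≢ (toℕ<n j) (trans e f)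

  UpBy-target : ∀ {s s′ u v v′} → val s ≡ val s′ → UpBy s u v → UpBy s′ u v′ → v ≡ v′
  UpBy-target {u = i , inj₁ x} eq (next e p) (next e′ p′) =
    ≡-vertex (trans e (sym e′)) (trans p (trans (cong (toℕ x +_) eq) (sym p′)))
  UpBy-target eq (next e _) (wrap w _) = ⊥-elim (Next-Wrap e w)
  UpBy-target eq (wrap w _) (next e _) = ⊥-elim (Next-Wrap e w)
  UpBy-target {s′ = s′} eq (wrap {y = y} (e , _) p) (wrap (e′ , _) p′) = ≡-vertex (trans e (sym e′))
    (+-cancelʳ-≡ (K * val s′) _ _ (trans (cong (λ t → toℕ y + K * t) (sym eq)) (trans (sym p) p′)))

  UpBy-source : ∀ {s s′ u u′ v} → val s ≡ val s′ → UpBy s u v → UpBy s′ u′ v → u ≡ u′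
  UpBy-source {s′ = s′} eq (next e p) (next e′ p′) = ≡-vertex (ℕ.suc-injective (trans (sym e) e′))
    (+-cancelʳ-≡ (val s′) _ _ (trans (cong (_ +_) (sym eq)) (trans (sym p) p′)))
  UpBy-source eq (next e _) (wrap (e′ , _) _) = contradiction (trans (sym e) e′) λ ()
  UpBy-source eq (wrap (e′ , _) _) (next e _) = contradiction (trans (sym e) e′) λ ()
  UpBy-source {v = j , inj₁ y} eq (wrap (_ , e) p) (wrap (_ , e′) p′) =
    ≡-vertex (ℕ.suc-injective (trans e (sym e′))) (trans p (trans (cong (λ t → toℕ y + K * t) eq) (sym p′)))

  UpBy-asym : ∀ {s s′ u v} → UpBy s u v → ¬ UpBy s′ v u
  UpBy-asym (next e _) (next e′ _) = m≢1+n+m _ (trans e′ (cong suc e))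
  -- These two steps can only reverse each other if `L` is 2.
  UpBy-asym (next e _) (wrap (e′ , f) _) = 2≢L (trans (cong (2 +_) (sym e′)) (trans (cong suc (sym e)) f))
    where
    2≢L : 2 ≢ L
    2≢L eq = contradiction (trans (ℕ.suc-injective eq) (*-suc 2 k)) λ ()
  UpBy-asym p@(wrap _ _) q@(next _ _) = UpBy-asym q p
  UpBy-asym (wrap (e , _) _) (wrap (_ , f) _) = contradiction (trans (cong suc (sym e)) f) λ ()

  -- Closed walks of length L carry a single label

  module Straight (average : ∀ ss u → length ss < L → ∑ ss val ≡ length ss * val u → All (_≡ u) ss) where

    module _ (y : ℕ → Vertex) where

      -- No edge leads from the last large layer to the first, so the layer itself grows, not just
      -- its residue; hence no such walk closes up.
      stays-U : ∀ t → (∀ i → i < t → Up (y i) (y (suc i))) → side (y 0) ≡ 1 →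
        side (y t) ≡ 1 × layer (y t) ≡ layer (y 0) + t
      stays-U zero    up e = e , sym (+-identityʳ _)
      stays-U (suc t) up e = step (y t) (y (suc t)) (stays-U t (λ i i<t → up i (m<n⇒m<1+n i<t)) e) (up t ≤-refl)
        where
        step : ∀ u v → side u ≡ 1 × layer u ≡ layer (y 0) + t → Up u v → side v ≡ 1 × layer v ≡ layer (y 0) + suc t
        step (i , inj₂ _) (j , inj₂ _) (_ , f) g = refl , trans g (trans (cong suc f) (sym (+-suc _ t)))

      -- `ss` collects the labels of the steps to the next layer and `ws` those of the wrapping
      -- steps; the latter lower the position, so their sum stands on the left.
      record Trace (t : ℕ) (v : Vertex) : Set where
        field
          ss ws : List S
          total     : length ss + length ws ≡ t
          on-V      : side v ≡ 0
          layers    : layer v + length ws * L ≡ layer (y 0) + t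
          positions : position v + K * ∑ ws val ≡ position (y 0) + ∑ ss val
          labelled  : ∀ i → i < t → ∃[ s ] ((s ∈ ss ⊎ s ∈ ws) × UpBy s (y i) (y (suc i)))

      trace : ∀ t → (∀ i → i < t → Up (y i) (y (suc i))) → side (y 0) ≡ 0 → Trace t (y t)
      trace zero    up e = record { ss = [] ; ws = [] ; total = refl ; on-V = e ; layers = refl
        ; positions = cong (position (y 0) +_) (*-zeroʳ K) ; labelled = λ i () }
      trace (suc t) up e = step (y t) (y (suc t)) refl refl (trace t (λ i i<t → up i (m<n⇒m<1+n i<t)) e) (up t ≤-refl)
        where
        step : ∀ u v → u ≡ y t → v ≡ y (suc t) → Trace t u → Up u v → Trace (suc t) v
        step (i , inj₁ x) (j , inj₁ x′) eu ev tr (inj₁ (nx , anys)) with Any.satisfied anys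
        ... | s , p = record
          { ss = s ∷ ss ; ws = ws ; total = cong suc total ; on-V = refl
          ; layers = trans (cong (_+ length ws * L) nx) (trans (cong suc layers) (sym (+-suc _ t)))
          ; positions = trans (cong (_+ K * ∑ ws val) p) (trans (arith₁ (toℕ x) (val s) (K * ∑ ws val))
              (trans (cong (val s +_) positions) (arith₂ (val s) (position (y 0)) (∑ ss val))))
          ; labelled = λ i i<1+t → extend i (m≤n⇒m<n∨m≡n (≤-pred i<1+t)) }
          where
          open Trace tr
          arith₁ : ∀ x a c → x + a + c ≡ a + (x + c)
          arith₁ = solve-∀
          arith₂ : ∀ a p s → a + (p + s) ≡ p + (a + s)
          arith₂ = solve-∀
          extend : ∀ i → i < t ⊎ i ≡ t → ∃[ s′ ] ((s′ ∈ s ∷ ss ⊎ s′ ∈ ws) × UpBy s′ (y i) (y (suc i)))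
          extend i (inj₁ i<t) with labelled i i<t
          ... | s′ , inj₁ q , r = s′ , inj₁ (there q) , r
          ... | s′ , inj₂ q , r = s′ , inj₂ q , r
          extend i (inj₂ refl) = s , inj₁ (here refl) , subst₂ (UpBy s) eu ev (next nx p)
        step (i , inj₁ x) (j , inj₁ x′) eu ev tr (inj₂ (wr , anys)) with Any.satisfied anys
        ... | s , p = record
          { ss = ss ; ws = s ∷ ws ; total = trans (+-suc _ _) (cong suc total) ; on-V = refl
          ; layers = trans (cong₂ _+_ (proj₁ wr) (cong (_+ length ws * L) (sym (proj₂ wr))))
              (trans (cong suc layers) (sym (+-suc _ t)))
          ; positions = trans (arith (toℕ x′) K (val s) (∑ ws val))
              (trans (cong (_+ K * ∑ ws val) (sym p)) positions)
          ; labelled = λ i i<1+t → extend i (m≤n⇒m<n∨m≡n (≤-pred i<1+t)) }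
          where
          open Trace tr
          arith : ∀ x K a w → x + K * (a + w) ≡ x + K * a + K * w
          arith = solve-∀
          extend : ∀ i → i < t ⊎ i ≡ t → ∃[ s′ ] ((s′ ∈ ss ⊎ s′ ∈ s ∷ ws) × UpBy s′ (y i) (y (suc i)))
          extend i (inj₁ i<t) with labelled i i<t
          ... | s′ , inj₁ q , r = s′ , inj₁ q , r
          ... | s′ , inj₂ q , r = s′ , inj₂ (there q) , r
          extend i (inj₂ refl) = s , inj₂ (here refl) , subst₂ (UpBy s) eu ev (wrap wr p)
        step (i , inj₂ x) (j , inj₂ x′) eu ev tr _ = contradiction (Trace.on-V tr) λ ()

      straighten : (∀ i → i < L → Up (y i) (y (suc i))) → y L ≡ y 0 →
        ∃[ s ] (∀ i → i < L → UpBy s (y i) (y (suc i)))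
      straighten up closed = by-side (y 0) refl
        where
        common : Trace L (y L) → ∃[ s ] (∀ i → i < L → UpBy s (y i) (y (suc i)))
        common tr with Trace.ws tr in eq | one-wrap
          where
          open Trace tr
          -- After `L` upward steps the walk is back in its layer, so `length ws * L` equals `L`.
          -- The position then equates the sum of `K` labels with `K` times the wrapping one, and
          -- `average` makes them all equal.
          one-wrap : length ws ≡ 1
          one-wrap = *-cancelʳ-≡ (length ws) 1 L (trans (+-cancelˡ-≡ (layer (y 0)) _ _
            (trans (cong (λ v → layer v + length ws * L) (sym closed)) layers)) (sym (*-identityˡ L)))
        ... | b ∷ [] | _ = b , λ i i<L → conclude (labelled i i<L)
          where
          open Trace tr
          len : length ss ≡ K
          len = ℕ.suc-injective (trans (+-comm 1 (length ss)) (trans (cong (λ w → length ss + length w) (sym eq)) total))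
          all-b : All (_≡ b) ss
          all-b = average ss b (≤-reflexive (cong suc len)) (sym (begin
            length ss * val b   ≡⟨ cong₂ _*_ len (sym (+-identityʳ (val b))) ⟩
            K * (val b + 0)     ≡⟨ cong (λ w → K * ∑ w val) (sym eq) ⟩
            K * ∑ ws val        ≡⟨ +-cancelˡ-≡ (position (y 0)) _ _ (trans (cong (λ v → position v + K * ∑ ws val) (sym closed)) positions) ⟩
            ∑ ss val            ∎))
            where open ≡-Reasoning
          conclude : ∀ {i} → ∃[ s ] ((s ∈ ss ⊎ s ∈ ws) × UpBy s (y i) (y (suc i))) → UpBy b (y i) (y (suc i))
          conclude (s , inj₁ s∈ , u) with All.lookup all-b s∈
          ... | refl = u
          conclude (s , inj₂ s∈ , u) with subst (s ∈_) eq s∈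
          ... | here refl = u
        by-side : ∀ v → v ≡ y 0 → ∃[ s ] (∀ i → i < L → UpBy s (y i) (y (suc i)))
        by-side (_ , inj₁ _) e = common (trace L up (cong side (sym e)))
        by-side (_ , inj₂ _) e = contradiction
          (trans (cong layer (sym closed)) (proj₂ (stays-U L up (cong side (sym e))))) (m≢m+n (layer (y 0)))
          where
          m≢m+n : ∀ m → m ≢ m + L
          m≢m+n m e = contradiction (+-cancelˡ-≡ m 0 L (trans (+-identityʳ m) e)) λ ()

    Directed : (ℕ → Vertex) → Set
    Directed z = ∃[ s ] ((∀ i → i < L → UpBy s (z i) (z (suc i))) ⊎ (∀ i → i < L → UpBy s (z (suc i)) (z i)))

    directed : ∀ z → (∀ i → i < L → Adj (z i) (z (suc i))) → z L ≡ z 0 → Directed z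
    directed z h closed with winds z h closed
    ... | inj₁ up with straighten z up closed
    ... | s , by = s , inj₁ by
    -- A walk that only goes down is reversed, straightened, and read backwards again.
    directed z h closed | inj₂ down with straighten (λ i → z (L ∸ i)) up′ (trans (cong z (n∸n≡0 L)) (sym closed))
      where
      up′ : ∀ i → i < L → Up (z (L ∸ i)) (z (L ∸ suc i))
      up′ i i<L = subst (λ j → Up (z j) (z (L ∸ suc i))) (sym (∸-suc′ i<L)) (down (L ∸ suc i) (s≤s (m∸n≤m K i)))
        where
        ∸-suc′ : ∀ {i} → i < L → L ∸ i ≡ suc (L ∸ suc i)
        ∸-suc′ {i} i<L = +-∸-assoc 1 (≤-pred i<L)
    ... | s , by = s , inj₂ λ i i<L → subst₂ (λ a b → UpBy s (z a) (z b))
        (m∸[m∸n]≡n i<L) (trans (cong (L ∸_) (sym (+-∸-assoc 1 i<L))) (m∸[m∸n]≡n (<⇒≤ i<L))) (by (L ∸ suc i) (s≤s (m∸n≤m K i)))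

    -- The first edge reveals the direction and the label, after which each vertex determines the
    -- next.
    directed-unique : ∀ z z′ → Directed z → Directed z′ → z 0 ≡ z′ 0 → z 1 ≡ z′ 1 → ∀ t → t ≤ L → z t ≡ z′ t
    directed-unique z z′ (s , inj₁ up) (s′ , inj₁ up′) e₀ e₁ = go
      where
      same : val s ≡ val s′
      same = UpBy-label (up 0 (s≤s z≤n)) (subst₂ (UpBy s′) (sym e₀) (sym e₁) (up′ 0 (s≤s z≤n)))
      go : ∀ t → t ≤ L → z t ≡ z′ t
      go zero    _   = e₀
      go (suc t) t<L = UpBy-target same (up t t<L) (subst (λ v → UpBy s′ v (z′ (suc t))) (sym (go t (<⇒≤ t<L))) (up′ t t<L))
    directed-unique z z′ (s , inj₂ dn) (s′ , inj₂ dn′) e₀ e₁ = go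
      where
      same : val s ≡ val s′
      same = UpBy-label (dn 0 (s≤s z≤n)) (subst₂ (UpBy s′) (sym e₁) (sym e₀) (dn′ 0 (s≤s z≤n)))
      go : ∀ t → t ≤ L → z t ≡ z′ t
      go zero    _   = e₀
      go (suc t) t<L = UpBy-source same (dn t t<L) (subst (UpBy s′ (z′ (suc t))) (sym (go t (<⇒≤ t<L))) (dn′ t t<L))
    directed-unique z z′ (s , inj₁ up) (s′ , inj₂ dn) e₀ e₁ = ⊥-elim
      (UpBy-asym (up 0 (s≤s z≤n)) (subst₂ (UpBy s′) (sym e₁) (sym e₀) (dn 0 (s≤s z≤n))))
    directed-unique z z′ (s , inj₂ dn) (s′ , inj₁ up) e₀ e₁ = ⊥-elim
      (UpBy-asym (dn 0 (s≤s z≤n)) (subst₂ (UpBy s′) (sym e₀) (sym e₁) (up 0 (s≤s z≤n))))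

-- Copies determined by their first two vertices

allMaps-Unique : ∀ n v → Unique (allMaps n v)
allMaps-Unique n zero    = [] ∷ []
allMaps-Unique n (suc v) = subst Unique (sym (product (allFin n) (allMaps n v)))
    (cartesianProductWith⁺ _∷_ ∷-injective (allFin⁺ n) (allMaps-Unique n v))
  where
  product : ∀ (xs : List (Fin n)) (ys : List (Vec (Fin n) v)) → concatMap (λ x → map (x ∷_) ys) xs ≡ cartesianProductWith {C = Vec (Fin n) (suc v)} _∷_ xs ys
  product []       ys = refl
  product (x ∷ xs) ys = cong (map (x ∷_) ys ++_) (product xs ys)

Unique-map-on : ∀ {A B : Set} {P : A → Set} (f : A → B) →
  (∀ {x y} → P x → P y → f x ≡ f y → x ≡ y) → ∀ {xs} → All P xs → Unique xs → Unique (map f xs)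
Unique-map-on f inj []         []         = []
Unique-map-on f inj (px ∷ pxs) (x∉ ∷ uxs) =
  All.map⁺ (All.zipWith (λ (py , x≢y) e → x≢y (inj px py e)) (pxs , x∉)) ∷ Unique-map-on f inj pxs uxs

copyCount≤n² : ∀ {v n} (H : Graph (2 + v)) (G : SimpleGraph n) →
  (∀ {f g} → IsCopy H G f → IsCopy H G g → lookup f zero ≡ lookup g zero →
    lookup f (suc zero) ≡ lookup g (suc zero) → f ≡ g) →
  copyCount H G ≤ n * n
copyCount≤n² {v} {n} H G determined = begin
  length cs                                  ≡⟨ sym (length-map ends cs) ⟩
  length (map ends cs)                       ≡⟨ sym (trans (∑-const (map ends cs) 1) (*-identityʳ _)) ⟩
  ∑ (map ends cs) (λ _ → 1)                  ≤⟨ ∑-Unique-⊆ (map ends cs) (cartesianProduct (allFin n) (allFin n)) _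
      (Unique-map-on ends (λ cf cg e → determined cf cg (cong proj₁ e) (cong proj₂ e)) are-copies
        (filter⁺ (T? ∘ isCopyᵇ H G) (allMaps-Unique n (2 + v))))
      (λ {e} _ → ∈-cartesianProduct⁺ (∈-allFin (proj₁ e)) (∈-allFin (proj₂ e))) ⟩
  ∑ (cartesianProduct (allFin n) (allFin n)) (λ _ → 1) ≡⟨ ∑-cartesianProduct (allFin n) (allFin n) _ ⟩
  ∑ (allFin n) (λ _ → ∑ (allFin n) (λ _ → 1))
    ≡⟨ trans (∑-cong (allFin n) λ _ → trans (∑-allFin-const n 1) (*-identityʳ n)) (∑-allFin-const n n) ⟩
  n * n ∎
  where
  open ≤-Reasoning
  cs = filterᵇ (isCopyᵇ H G) (allMaps n (2 + v))
  ends : Vec (Fin n) (2 + v) → Fin n × Fin n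
  ends f = lookup f zero , lookup f (suc zero)
  are-copies : All (IsCopy H G) cs
  are-copies = All.tabulate λ f∈ → proj₂ (∈-filter⁻ (T? ∘ isCopyᵇ H G) {xs = allMaps n (2 + v)} f∈)

line-unique-< : ∀ {x x′ v v′ a b} → a < b → x + a * v ≡ x′ + a * v′ → x + b * v ≡ x′ + b * v′ → x ≡ x′ × v ≡ v′
line-unique-< {x} {x′} {v} {v′} {a} {b} a<b p q =
  +-cancelʳ-≡ (a * v) x x′ (trans p (cong (λ t → x′ + a * t) (sym v≡v′))) , v≡v′
  where
  c = b ∸ a
  split : ∀ x v → x + b * v ≡ x + a * v + c * v
  split x v = trans (cong (λ b → x + b * v) (sym (m+[n∸m]≡n (<⇒≤ a<b)))) (arith x a c v)
    where
    arith : ∀ x a c v → x + (a + c) * v ≡ x + a * v + c * v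
    arith = solve-∀
  v≡v′ : v ≡ v′
  v≡v′ = *-cancelˡ-≡ v v′ c {{>-nonZero (m<n⇒0<n∸m a<b)}} (+-cancelˡ-≡ (x + a * v) _ _
    (trans (sym (split x v)) (trans q (trans (split x′ v′) (cong (_+ c * v′) (sym p))))))

-- Two planted cycles that share an edge are lines `x + t * v` that agree at two values of `t`.
line-unique : ∀ {x x′ v v′ a b} → a ≢ b → x + a * v ≡ x′ + a * v′ → x + b * v ≡ x′ + b * v′ → x ≡ x′ × v ≡ v′
line-unique {a = a} {b} a≢b p q with <-cmp a b
... | tri< a<b _ _ = line-unique-< a<b p q
... | tri≈ _ e _   = contradiction e a≢b
... | tri> _ _ b<a = line-unique-< b<a q p

cycleSucc⇒ : ∀ L a b → T (cycleSucc L a b) → toℕ b ≡ suc (toℕ a) ⊎ (toℕ b ≡ 0 × suc (toℕ a) ≡ L)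
cycleSucc⇒ L a b t with Equivalence.to (T-∨ {toℕ b ≡ᵇ suc (toℕ a)}) t
... | inj₁ e = inj₁ (≡ᵇ⇒≡ _ _ e)
... | inj₂ e with Equivalence.to (T-∧ {toℕ b ≡ᵇ 0}) e
... | e₁ , e₂ = inj₂ (≡ᵇ⇒≡ _ _ e₁ , ≡ᵇ⇒≡ _ _ e₂)

-- The graph and its planted cycles

module Construction (k : ℕ) {S : Set} (labels : List S)
  (labels-Unique : Unique labels) (labels-complete : ∀ s → s ∈ labels) (val : S → ℕ)
  (average : ∀ ss u → length ss < suc (2 * suc k) → ∑ ss val ≡ length ss * val u → All (_≡ u) ss)
  (b : ℕ) (val<b : ∀ s → val s < b) (M : ℕ) where

  -- Room for a starting point below `b` followed by `K` steps below `b` each.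
  N = suc (2 * suc k) * b

  open Layered k labels val N M
  open Straight average

  n : ℕ
  n = L * (N + M)

  decode : Fin n → Vertex
  decode u = proj₁ (remQuot {L} (N + M) u) , splitAt N (proj₂ (remQuot {L} (N + M) u))

  encode : Vertex → Fin n
  encode (i , x) = combine i (join N M x)

  decode∘encode : ∀ v → decode (encode v) ≡ v
  decode∘encode (i , x) = cong₂ _,_ (cong proj₁ (remQuot-combine i (join N M x)))
    (trans (cong (splitAt N ∘ proj₂) (remQuot-combine {L} i (join N M x))) (splitAt-join N M x))

  encode∘decode : ∀ u → encode (decode u) ≡ u
  encode∘decode u = trans (cong (combine (proj₁ (remQuot {L} (N + M) u))) (join-splitAt N M _))
    (combine-remQuot {L} (N + M) u)

  decode-injective : ∀ {u v} → decode u ≡ decode v → u ≡ v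
  decode-injective {u} {v} e = trans (sym (encode∘decode u)) (trans (cong encode e) (encode∘decode v))

  encode-injective : ∀ {u v} → encode u ≡ encode v → u ≡ v
  encode-injective {u} {v} e = trans (sym (decode∘encode u)) (trans (cong decode e) (decode∘encode v))

  graph : SimpleGraph n
  graph = record
    { adj    = λ u v → does (Adj? (decode u) (decode v))
    ; sym    = λ u v → Adj?-sym (decode u) (decode v)
    ; irrefl = λ u → dec-false (Adj? (decode u) (decode u)) (Adj-irrefl (decode u))
    }

  degree-bound : ∀ u (g : Fin M → Vertex) → (∀ {x y} → g x ≡ g y → x ≡ y) →
    (∀ y → Adj (decode u) (g y)) → M ≤ degree graph u
  degree-bound u g g-inj adjacent = begin
    M                                          ≡⟨ sym (trans (∑-allFin-const M 1) (*-identityʳ M)) ⟩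
    ∑ (allFin M) (λ _ → 1)                     ≡⟨ ∑-cong (allFin M) (λ y → sym (T⇒𝟙 (T-does⁺ (Adj? (decode u) (decode (encode (g y))))
                                                    (subst (Adj (decode u)) (sym (decode∘encode (g y))) (adjacent y))))) ⟩
    ∑ (allFin M) (λ y → 𝟙 (adj graph u (encode (g y)))) ≡⟨ sym (∑-map (encode ∘ g) (allFin M) _) ⟩
    ∑ (map (encode ∘ g) (allFin M)) (λ v → 𝟙 (adj graph u v)) ≤⟨ ∑-Unique-⊆ _ (allFin n) _
                                                    (map⁺ (g-inj ∘ encode-injective) (allFin⁺ M)) (λ _ → ∈-allFin _) ⟩
    degree graph u                             ∎
    where open ≤-Reasoning

  minDegree : ∀ u → M ≤ degree graph u
  minDegree u = by-side (decode u) refl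
    where
    inj₂-injective : ∀ {i : Fin L} {x y : Fin M} → _≡_ {A = Vertex} (i , inj₂ x) (i , inj₂ y) → x ≡ y
    inj₂-injective refl = refl
    by-side : ∀ v → v ≡ decode u → M ≤ degree graph u
    by-side (i , inj₁ x) e = degree-bound u (λ y → i , inj₂ y) inj₂-injective
      (λ y → subst (λ v → Adj v _) e (inj₂ (inj₁ refl)))
    -- As the first and the last large layer are not joined, the first one uses the layer above it
    -- and every other one the layer below.
    by-side (zero , inj₂ x) e = degree-bound u (λ y → suc zero , inj₂ y) inj₂-injective
      (λ y → subst (λ v → Adj v _) e (inj₁ (inj₁ refl)))
    by-side (suc i , inj₂ x) e = degree-bound u (λ y → inject₁ i , inj₂ y) inj₂-injective
      (λ y → subst (λ v → Adj v _) e (inj₁ (inj₂ (cong suc (sym (toℕ-inject₁ i))))))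

  -- The copy is read cyclically, so that index `L` returns to the start, as `directed` requires.
  along : Vec (Fin n) L → ℕ → Vertex
  along f t = decode (lookup f (t mod L))

  toℕ-mod : ∀ t → toℕ (t mod L) ≡ t % L
  toℕ-mod t = toℕ-fromℕ< (m%n<n t L)

  toℕ-mod-< : ∀ {t} → t < L → toℕ (t mod L) ≡ t
  toℕ-mod-< {t} t<L = trans (toℕ-mod t) (m<n⇒m%n≡m t<L)

  mod-step : ∀ i → i < L → T (Cycle L (i mod L) (suc i mod L))
  mod-step i i<L with m≤n⇒m<n∨m≡n i<L
  ... | inj₁ 1+i<L = step-up (i mod L) (suc i mod L) (trans (toℕ-mod-< 1+i<L) (cong suc (sym (toℕ-mod-< i<L))))
  ... | inj₂ refl  = step-wrap (i mod L) (suc i mod L) (trans (toℕ-mod L) (n%n≡0 L)) (cong suc (toℕ-mod-< i<L))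

  copy-directed : ∀ f → IsCopy (Cycle L) graph f → Directed (along f)
  copy-directed f c = directed (along f)
    (λ i i<L → T-does⁻ (Adj? _ _) (IsCopy⇒adj (Cycle L) graph f c (i mod L) (suc i mod L) (mod-step i i<L)))
    (cong (decode ∘ lookup f) (toℕ-injective (trans (toℕ-mod L) (trans (n%n≡0 L) (sym (toℕ-mod-< (s≤s z≤n)))))))

  few-copies : copyCount (Cycle L) graph ≤ n * n
  few-copies = copyCount≤n² (Cycle L) graph λ {f} {g} cf cg e₀ e₁ →
    lookup-ext f g λ a → decode-injective (subst (λ i → decode (lookup f i) ≡ decode (lookup g i)) (toℕ-mod-id a)
      (directed-unique (along f) (along g) (copy-directed f cf) (copy-directed g cg)
        (cong decode (subst (λ i → lookup f i ≡ lookup g i) (toℕ-injective (sym (toℕ-mod-< {0} (s≤s z≤n)))) e₀))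
        (cong decode (subst (λ i → lookup f i ≡ lookup g i) (toℕ-injective (sym (toℕ-mod-< {1} (s≤s (s≤s z≤n))))) e₁))
        (toℕ a) (<⇒≤ (toℕ<n a))))
    where
    toℕ-mod-id : ∀ a → toℕ a mod L ≡ a
    toℕ-mod-id a = toℕ-injective (toℕ-mod-< (toℕ<n a))
    lookup-ext : ∀ (f g : Vec (Fin n) L) → (∀ a → lookup f a ≡ lookup g a) → f ≡ g
    lookup-ext f g e = trans (sym (tabulate∘lookup f)) (trans (tabulate-cong e) (tabulate∘lookup g))

  point-< : ∀ (x : Fin b) s (i : Fin L) → toℕ x + toℕ i * val s < N
  point-< x s i = +-mono-<-≤ (toℕ<n x) (*-mono-≤ (≤-pred (toℕ<n i)) (<⇒≤ (val<b s)))

  -- The planted cycles are arithmetic progressions; the last term exceeds the first by `K * val s`,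
  -- exactly the shift of a wrapping edge.
  point : Fin b × S → Fin L → Vertex
  point (x , s) i = i , inj₁ (fromℕ< (point-< x s i))

  cycle : Fin b × S → Vec (Fin n) L
  cycle xs = tabulate (encode ∘ point xs)

  decode-cycle : ∀ xs i → decode (lookup (cycle xs) i) ≡ point xs i
  decode-cycle xs i = trans (cong decode (lookup∘tabulate (encode ∘ point xs) i)) (decode∘encode (point xs i))

  point-Up : ∀ xs i j → T (cycleSucc L i j) → Up (point xs i) (point xs j)
  point-Up (x , s) i j t with cycleSucc⇒ L i j t
  ... | inj₁ e = inj₁ (e , Any.map (λ { refl → eq }) (labels-complete s))
    where
    open ≡-Reasoning
    arith : ∀ x i v → x + suc i * v ≡ x + i * v + v
    arith = solve-∀
    eq : toℕ (fromℕ< (point-< x s j)) ≡ toℕ (fromℕ< (point-< x s i)) + val s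
    eq = begin
      toℕ (fromℕ< (point-< x s j))           ≡⟨ toℕ-fromℕ< (point-< x s j) ⟩
      toℕ x + toℕ j * val s                  ≡⟨ cong (λ t → toℕ x + t * val s) e ⟩
      toℕ x + suc (toℕ i) * val s            ≡⟨ arith (toℕ x) (toℕ i) (val s) ⟩
      toℕ x + toℕ i * val s + val s          ≡⟨ cong (_+ val s) (sym (toℕ-fromℕ< (point-< x s i))) ⟩
      toℕ (fromℕ< (point-< x s i)) + val s   ∎
  ... | inj₂ (e , f) = inj₂ ((e , f) , Any.map (λ { refl → eq }) (labels-complete s))
    where
    open ≡-Reasoning
    eq : toℕ (fromℕ< (point-< x s i)) ≡ toℕ (fromℕ< (point-< x s j)) + K * val s
    eq = begin
      toℕ (fromℕ< (point-< x s i))           ≡⟨ toℕ-fromℕ< (point-< x s i) ⟩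
      toℕ x + toℕ i * val s                  ≡⟨ cong₂ (λ y t → y + t * val s)
                                                  (trans (sym (+-identityʳ _)) (cong (λ t → toℕ x + t * val s) (sym e))) (ℕ.suc-injective f) ⟩
      toℕ x + toℕ j * val s + K * val s      ≡⟨ cong (_+ K * val s) (sym (toℕ-fromℕ< (point-< x s j))) ⟩
      toℕ (fromℕ< (point-< x s j)) + K * val s ∎

  cycle-copy : ∀ xs → IsCopy (Cycle L) graph (cycle xs)
  cycle-copy xs = IsCopy⁺ (Cycle L) graph (cycle xs) λ i j → Equivalence.from T-∧ (distinct i j , adjacent i j)
    where
    distinct : ∀ i j → T (does (i ≟ j) ∨ not (does (lookup (cycle xs) i ≟ lookup (cycle xs) j)))
    distinct i j with i ≟ j
    ... | yes _ = _
    ... | no i≢j = subst (T ∘ not) (sym (dec-false (lookup (cycle xs) i ≟ lookup (cycle xs) j)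
        λ e → i≢j (cong proj₁ (trans (sym (decode-cycle xs i)) (trans (cong decode e) (decode-cycle xs j)))))) _
    Adj-points : ∀ i j → T (Cycle L i j) → Adj (point xs i) (point xs j)
    Adj-points i j t with Equivalence.to (T-∨ {cycleSucc L i j}) t
    ... | inj₁ e = inj₁ (inj₁ (point-Up xs i j e))
    ... | inj₂ e = inj₁ (inj₂ (point-Up xs j i e))
    adjacent : ∀ i j → T (not (Cycle L i j) ∨ adj graph (lookup (cycle xs) i) (lookup (cycle xs) j))
    adjacent i j with Cycle L i j in eq
    ... | false = _
    ... | true  = T-does⁺ (Adj? _ _) (subst₂ Adj (sym (decode-cycle xs i)) (sym (decode-cycle xs j))
        (Adj-points i j (Equivalence.from T-≡ eq)))

  cycleSucc-irrefl : ∀ i → ¬ T (cycleSucc L i i)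
  cycleSucc-irrefl i e with cycleSucc⇒ L i i e
  ... | inj₁ p       = 1+n≢n (sym p)
  ... | inj₂ (p , q) = contradiction (trans (cong suc (sym p)) q) λ ()

  Cycle⇒≢ : ∀ i j → T (Cycle L i j) → i ≢ j
  Cycle⇒≢ i j t refl with Equivalence.to (T-∨ {cycleSucc L i i}) t
  ... | inj₁ e = cycleSucc-irrefl i e
  ... | inj₂ e = cycleSucc-irrefl i e

  cycles-disjoint : ∀ xs ys → xs ≢ ys → EdgeDisjoint (Cycle L) (cycle xs) (cycle ys)
  cycles-disjoint xs@(x , s) ys@(y , s′) xs≢ys i j i′ j′ hij _ (e , f) with same i i′ e | same j j′ f
    where
    same : ∀ i i′ → lookup (cycle xs) i ≡ lookup (cycle ys) i′ → i ≡ i′ × toℕ x + toℕ i * val s ≡ toℕ y + toℕ i′ * val s′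
    same i i′ e = cong proj₁ eq , trans (sym (toℕ-fromℕ< (point-< x s i))) (trans (cong position eq) (toℕ-fromℕ< (point-< y s′ i′)))
      where
      eq : point xs i ≡ point ys i′
      eq = trans (sym (decode-cycle xs i)) (trans (cong decode e) (decode-cycle ys i′))
  ... | refl , p | refl , q with line-unique (Cycle⇒≢ i j hij ∘ toℕ-injective) p q
  -- For a one-element list `average` says that `val` is injective.
  ... | x≡y , v≡v′ = xs≢ys (cong₂ _,_ (toℕ-injective x≡y)
      (All.head (average (s ∷ []) s′ (s≤s (s≤s z≤n)) (cong (_+ 0) v≡v′))))

  cycles : List (Vec (Fin n) L)
  cycles = map cycle (cartesianProduct (allFin b) labels)

  cycles-EdgeDisjoint : AllPairs (EdgeDisjoint (Cycle L)) cycles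
  cycles-EdgeDisjoint = AllPairs.map⁺ (AllPairs.map (λ {xs} {ys} → cycles-disjoint xs ys)
    (cartesianProduct⁺ (allFin⁺ b) labels-Unique))

  cycles-copies : All (IsCopy (Cycle L) graph) cycles
  cycles-copies = All.map⁺ (All.universal cycle-copy _)

  length-cycles : length cycles ≡ b * length labels
  length-cycles = begin
    length cycles                                             ≡⟨ length-map cycle (cartesianProduct (allFin b) labels) ⟩
    length (cartesianProduct (allFin b) labels)               ≡⟨ sym (trans (∑-const (cartesianProduct (allFin b) labels) 1) (*-identityʳ _)) ⟩
    ∑ (cartesianProduct (allFin b) labels) (λ _ → 1)          ≡⟨ ∑-cartesianProduct (allFin b) labels _ ⟩
    ∑ (allFin b) (λ _ → ∑ labels (λ _ → 1))                   ≡⟨ trans (∑-allFin-const b _) (cong (b *_) (trans (∑-const labels 1) (*-identityʳ _))) ⟩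
    b * length labels                                         ∎
    where open ≡-Reasoning

-- Rational inequalities as inequalities between natural numbers

open import Data.Integer using (+_; -[1+_])

-- Fraction x a b says that x = a / b (for b ≠ 0).
record Fraction (x : ℚ) (a b : ℕ) : Set where
  constructor fraction
  field scaled : x ℚ.* ℕtoℚ b ≡ ℕtoℚ a
open Fraction

ℕtoℚᵘ : ∀ n → ℚ.toℚᵘ (ℕtoℚ n) ℚᵘ.≃ mkℚᵘ (+ n) 0
ℕtoℚᵘ n = ℚ.toℚᵘ-fromℚᵘ (mkℚᵘ (+ n) 0)

ℕtoℚ-* : ∀ a b → ℕtoℚ (a * b) ≡ ℕtoℚ a ℚ.* ℕtoℚ b
ℕtoℚ-* a b = ℚ.toℚᵘ-injective (begin-equality
  ℚ.toℚᵘ (ℕtoℚ (a * b))                   ≃⟨ ℕtoℚᵘ (a * b) ⟩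
  mkℚᵘ (+ (a * b)) 0                      ≃⟨ *≡* (cong (ℤ._* + 1) (ℤ.pos-* a b)) ⟩
  mkℚᵘ (+ a) 0 ℚᵘ.* mkℚᵘ (+ b) 0          ≃⟨ ℚᵘ.*-cong (ℚᵘ.≃-sym (ℕtoℚᵘ a)) (ℚᵘ.≃-sym (ℕtoℚᵘ b)) ⟩
  ℚ.toℚᵘ (ℕtoℚ a) ℚᵘ.* ℚ.toℚᵘ (ℕtoℚ b)    ≃⟨ ℚᵘ.≃-sym (ℚ.toℚᵘ-homo-* (ℕtoℚ a) (ℕtoℚ b)) ⟩
  ℚ.toℚᵘ (ℕtoℚ a ℚ.* ℕtoℚ b)              ∎)
  where open ℚᵘ.≤-Reasoning

ℕtoℚ-mono : ∀ {a b} → a ≤ b → ℕtoℚ a ℚ.≤ ℕtoℚ b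
ℕtoℚ-mono {a} {b} a≤b = ℚ.toℚᵘ-cancel-≤ (begin
  ℚ.toℚᵘ (ℕtoℚ a) ≃⟨ ℕtoℚᵘ a ⟩
  mkℚᵘ (+ a) 0    ≤⟨ *≤* (ℤ.*-monoʳ-≤-nonNeg (+ 1) (ℤ.+≤+ a≤b)) ⟩
  mkℚᵘ (+ b) 0    ≃⟨ ℚᵘ.≃-sym (ℕtoℚᵘ b) ⟩
  ℚ.toℚᵘ (ℕtoℚ b) ∎)
  where open ℚᵘ.≤-Reasoning

ℕtoℚ-cancel : ∀ {a b} → ℕtoℚ a ℚ.≤ ℕtoℚ b → a ≤ b
ℕtoℚ-cancel {a} {b} le with
  ℚᵘ.≤-trans (ℚᵘ.≤-reflexive (ℚᵘ.≃-sym (ℕtoℚᵘ a))) (ℚᵘ.≤-trans (ℚ.toℚᵘ-mono-≤ le) (ℚᵘ.≤-reflexive (ℕtoℚᵘ b)))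
... | *≤* le′ = ℤ.drop‿+≤+ (subst₂ ℤ._≤_ (ℤ.*-identityʳ (+ a)) (ℤ.*-identityʳ (+ b)) le′)

ℕtoℚ-nonNeg : ∀ a → ℚ.NonNegative (ℕtoℚ a)
ℕtoℚ-nonNeg a = ℚ.nonNegative (ℕtoℚ-mono {0} {a} z≤n)

ℕtoℚ-pos : ∀ a → .{{NonZero a}} → ℚ.Positive (ℕtoℚ a)
ℕtoℚ-pos a {{nz}} = ℚ.normalize-pos a 1 {{_}} {{nz}}

Fraction-ℕ : ∀ a → Fraction (ℕtoℚ a) a 1
Fraction-ℕ a = fraction (ℚ.*-identityʳ (ℕtoℚ a))

private
  Fractionᵘ : ∀ x a d → ℚ.toℚᵘ x ℚᵘ.≃ mkℚᵘ (+ a) d → Fraction x a (suc d)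
  Fractionᵘ x a d x≃ = fraction (ℚ.toℚᵘ-injective (begin-equality
    ℚ.toℚᵘ (x ℚ.* ℕtoℚ (suc d))            ≃⟨ ℚ.toℚᵘ-homo-* x (ℕtoℚ (suc d)) ⟩
    ℚ.toℚᵘ x ℚᵘ.* ℚ.toℚᵘ (ℕtoℚ (suc d))    ≃⟨ ℚᵘ.*-cong x≃ (ℕtoℚᵘ (suc d)) ⟩
    mkℚᵘ (+ a) d ℚᵘ.* mkℚᵘ (+ suc d) 0     ≃⟨ *≡* (ℤ.*-assoc (+ a) (+ suc d) (+ 1)) ⟩
    mkℚᵘ (+ a) 0                           ≃⟨ ℚᵘ.≃-sym (ℕtoℚᵘ a) ⟩
    ℚ.toℚᵘ (ℕtoℚ a)                        ∎))
    where open ℚᵘ.≤-Reasoning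

Fraction-/ : ∀ a b → .{{_ : NonZero b}} → Fraction (+ a ℚ./ b) a b
Fraction-/ a (suc b) = Fractionᵘ _ a b (ℚ.toℚᵘ-fromℚᵘ (mkℚᵘ (+ a) b))

nonNeg⇒Fraction : ∀ x → 0ℚ ℚ.≤ x → ∃₂ λ a b → Fraction x a (suc b)
nonNeg⇒Fraction x@(mkℚ (+ a) b _)  _ = a , b , Fractionᵘ x a b ℚᵘ.≃-refl
nonNeg⇒Fraction (mkℚ -[1+ a ] b _) (ℚ.*≤* ())

Fraction-* : ∀ {x y a b c d} → Fraction x a b → Fraction y c d → Fraction (x ℚ.* y) (a * c) (b * d)
Fraction-* {x} {y} {a} {b} {c} {d} p q = fraction (begin
  x ℚ.* y ℚ.* ℕtoℚ (b * d)                 ≡⟨ cong (x ℚ.* y ℚ.*_) (ℕtoℚ-* b d) ⟩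
  x ℚ.* y ℚ.* (ℕtoℚ b ℚ.* ℕtoℚ d)          ≡⟨ interchange x y (ℕtoℚ b) (ℕtoℚ d) ⟩
  (x ℚ.* ℕtoℚ b) ℚ.* (y ℚ.* ℕtoℚ d)        ≡⟨ cong₂ ℚ._*_ (scaled p) (scaled q) ⟩
  ℕtoℚ a ℚ.* ℕtoℚ c                        ≡⟨ sym (ℕtoℚ-* a c) ⟩
  ℕtoℚ (a * c)                             ∎)
  where
  open ≡-Reasoning

Fraction-^ : ∀ {x a b} j → Fraction x a b → Fraction (x ^ℚ j) (a ^ j) (b ^ j)
Fraction-^ zero    p = fraction refl
Fraction-^ (suc j) p = Fraction-* p (Fraction-^ j p)

private
  cross : ∀ {x a b} d → Fraction x a b → x ℚ.* ℕtoℚ (b * d) ≡ ℕtoℚ (a * d)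
  cross {x} {a} {b} d p = begin
    x ℚ.* ℕtoℚ (b * d)              ≡⟨ cong (x ℚ.*_) (ℕtoℚ-* b d) ⟩
    x ℚ.* (ℕtoℚ b ℚ.* ℕtoℚ d)       ≡⟨ sym (ℚ.*-assoc x _ _) ⟩
    x ℚ.* ℕtoℚ b ℚ.* ℕtoℚ d         ≡⟨ cong (ℚ._* ℕtoℚ d) (scaled p) ⟩
    ℕtoℚ a ℚ.* ℕtoℚ d               ≡⟨ sym (ℕtoℚ-* a d) ⟩
    ℕtoℚ (a * d)                    ∎
    where open ≡-Reasoning

Fraction-≤⁻ : ∀ {x y a b c d} → Fraction x a b → Fraction y c d → x ℚ.≤ y → a * d ≤ c * b
Fraction-≤⁻ {x} {y} {a} {b} {c} {d} p q x≤y = ℕtoℚ-cancel (subst₂ ℚ._≤_ (cross d p)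
  (trans (cong (λ t → y ℚ.* ℕtoℚ t) (*-comm b d)) (cross b q))
  (ℚ.*-monoʳ-≤-nonNeg (ℕtoℚ (b * d)) {{ℕtoℚ-nonNeg (b * d)}} x≤y))

Fraction-≤⁺ : ∀ {x y a b c d} → .{{_ : NonZero b}} → .{{_ : NonZero d}} →
  Fraction x a b → Fraction y c d → a * d ≤ c * b → x ℚ.≤ y
Fraction-≤⁺ {x} {y} {a} {b} {c} {d} p q le =
  ℚ.*-cancelʳ-≤-pos (ℕtoℚ (b * d)) {{ℕtoℚ-pos (b * d) {{m*n≢0 b d}}}} (subst₂ ℚ._≤_ (sym (cross d p))
    (sym (trans (cong (λ t → y ℚ.* ℕtoℚ t) (*-comm b d)) (cross b q))) (ℕtoℚ-mono le))

Fraction-bound : ∀ q → .{{_ : NonZero q}} → ∀ {ε E F} → .{{_ : NonZero F}} → Fraction ε E F → ∀ X Z →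
  E ^ q * X ≤ q * F ^ q * Z →
  (+ 1 ℚ./ q) ^ℚ 1 ℚ.* ε ^ℚ q ℚ.* ℕtoℚ X ^ℚ 1 ℚ.≤ ℕtoℚ Z ^ℚ 1
Fraction-bound q {ε} {E} {F} ε≡ X Z le = Fraction-≤⁺
  {{m*n≢0 (q ^ 1 * F ^ q) 1 {{m*n≢0 (q ^ 1) (F ^ q) {{m^n≢0 q 1}} {{m^n≢0 F q}}}}}}
  (Fraction-* (Fraction-* (Fraction-^ 1 (Fraction-/ 1 q)) (Fraction-^ q ε≡)) (Fraction-^ 1 (Fraction-ℕ X)))
  (Fraction-^ 1 (Fraction-ℕ Z))
  (≤-trans (≤-reflexive (lhs (E ^ q) X)) (≤-trans le (≤-reflexive (rhs Z q (F ^ q)))))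
  where
  lhs : ∀ e x → 1 * e * (x * 1) * 1 ≡ e * x
  lhs = solve-∀
  rhs : ∀ z q f → q * f * z ≡ z * 1 * (q * 1 * f * 1)
  rhs = solve-∀

scaled-≤ : ∀ {x P D} m n → Fraction x P D → x ℚ.* ℕtoℚ m ℚ.≤ ℕtoℚ n → P * m ≤ D * n
scaled-≤ {x} {P} {D} m n x≡ le = subst₂ _≤_ (*-identityʳ (P * m))
  (trans (cong (n *_) (*-identityʳ D)) (*-comm n D))
  (Fraction-≤⁻ (Fraction-* x≡ (Fraction-ℕ m)) (Fraction-ℕ n) le)

-- One number `q` has to serve both as the exponent of ε and as the reciprocal of μ; `suc (a + Q)`
-- is large enough for both. Raising the exponent beyond `a` is harmless because `m ≤ s` forces
-- `E ≤ F`, that is, ε is at most 1.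
power-bound : ∀ a Q {E F m s X Z} → .{{_ : NonZero s}} → E * s ≤ F * m → m ≤ s →
  m ^ a * X ≤ Q * Z * s ^ a →
  E ^ suc (a + Q) * X ≤ suc (a + Q) * F ^ suc (a + Q) * Z
power-bound a Q {E} {F} {m} {s} {X} {Z} Es≤Fm m≤s le = begin
  E ^ q * X                     ≡⟨ cong (λ i → E ^ i * X) q≡ ⟩
  E ^ (suc Q + a) * X           ≡⟨ cong (_* X) (^-distribˡ-+-* E (suc Q) a) ⟩
  E ^ suc Q * E ^ a * X         ≡⟨ *-assoc (E ^ suc Q) _ _ ⟩
  E ^ suc Q * (E ^ a * X)       ≤⟨ *-mono-≤ (^-monoˡ-≤ (suc Q) E≤F) main ⟩
  F ^ suc Q * (F ^ a * (Q * Z)) ≡⟨ arith (F ^ suc Q) (F ^ a) Q Z ⟩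
  Q * (F ^ suc Q * F ^ a) * Z   ≡⟨ cong (λ t → Q * t * Z) (trans (sym (^-distribˡ-+-* F (suc Q) a)) (cong (F ^_) (sym q≡))) ⟩
  Q * F ^ q * Z                 ≤⟨ *-monoˡ-≤ Z (*-monoˡ-≤ (F ^ q) (≤-trans (m≤n+m Q a) (n≤1+n _))) ⟩
  q * F ^ q * Z                 ∎
  where
  open ≤-Reasoning
  q = suc (a + Q)
  q≡ : q ≡ suc Q + a
  q≡ = cong suc (+-comm a Q)
  arith : ∀ x y Q Z → x * (y * (Q * Z)) ≡ Q * (x * y) * Z
  arith = solve-∀
  swap : ∀ a b c → a * b * c ≡ a * c * b
  swap = solve-∀
  E≤F : E ≤ F
  E≤F = *-cancelʳ-≤ E F s (≤-trans Es≤Fm (*-monoʳ-≤ F m≤s))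
  main : E ^ a * X ≤ F ^ a * (Q * Z)
  main = *-cancelʳ-≤ _ _ (s ^ a) {{m^n≢0 s a}} (begin
    E ^ a * X * s ^ a          ≡⟨ swap (E ^ a) X (s ^ a) ⟩
    E ^ a * s ^ a * X          ≡⟨ cong (_* X) (sym (^-distribʳ-* a E s)) ⟩
    (E * s) ^ a * X            ≤⟨ *-monoˡ-≤ X (^-monoˡ-≤ a Es≤Fm) ⟩
    (F * m) ^ a * X            ≡⟨ cong (_* X) (^-distribʳ-* a F m) ⟩
    F ^ a * m ^ a * X          ≡⟨ *-assoc (F ^ a) _ _ ⟩
    F ^ a * (m ^ a * X)        ≤⟨ *-monoʳ-≤ (F ^ a) le ⟩
    F ^ a * (Q * Z * s ^ a)    ≡⟨ sym (*-assoc (F ^ a) _ _) ⟩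
    F ^ a * (Q * Z) * s ^ a    ∎)

-- Polynomial removal above the threshold

polyRemoval-above : ∀ k {t γ P D} → Fraction t 1 (suc (2 * suc k)) → Fraction γ P (suc D) → t ℚ.< γ →
  PolyRemoval (Cycle (suc (2 * suc k))) γ
polyRemoval-above k {t} {γ} {P} {D} t≡ γ≡ t<γ = 1 , suc (a + Q) , _ , _ , λ ε 0<ε →
  bound ε (nonNeg⇒Fraction ε (ℚ.<⇒≤ 0<ε))
  where
  L = suc (2 * suc k)
  a = suc (2 * k) * L
  Q = proj₁ (many-copies k (suc D) P)
  -- Between integers the strict inequality `t < γ` gains a whole unit, which is the surplus that
  -- `many-hits` consumes.
  D<LP : suc (suc D) ≤ L * P
  D<LP = ≰⇒> λ le → ℚ.<-irrefl refl (ℚ.<-≤-trans t<γ (Fraction-≤⁺ γ≡ t≡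
    (≤-trans (≤-reflexive (*-comm P L)) (≤-trans le (≤-reflexive (sym (*-identityˡ (suc D))))))))
  count : ∀ {E F} n (G : SimpleGraph n) → MinDegreeAtLeast G γ → ∀ fs → All (IsCopy (Cycle L) G) fs →
    AllPairs (EdgeDisjoint (Cycle L)) fs → E * (n * n) ≤ F * length fs →
    E ^ suc (a + Q) * n ^ L ≤ suc (a + Q) * F ^ suc (a + Q) * copyCount (Cycle L) G
  count {E} zero  G deg fs copies disjoint le = ≤-trans (≤-reflexive (*-zeroʳ (E ^ suc (a + Q)))) z≤n
  count {E} {F} n@(suc _) G deg fs copies disjoint le = power-bound a Q {E} {F} le (copies≤n² G k fs disjoint)
    (proj₂ (many-copies k (suc D) P) n G D<LP (λ i → scaled-≤ n (degree G i) γ≡ (deg i)) fs copies disjoint)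
  bound : ∀ ε → (∃₂ λ E F → Fraction ε E (suc F)) → δ≥με^1/μ (Cycle L) γ 1 (suc (a + Q)) ε
  bound ε (E , F , ε≡) n G deg (fs , copies , disjoint , many) =
    Fraction-bound (suc (a + Q)) ε≡ (n ^ L) (copyCount (Cycle L) G)
      (count {E} {suc F} n G deg fs copies disjoint (scaled-≤ (n * n) (length fs) ε≡ many))

-- Failure of polynomial removal below the threshold

scaled-≤⁺ : ∀ {x P D} m n → .{{_ : NonZero D}} → Fraction x P D → P * m ≤ D * n → x ℚ.* ℕtoℚ m ℚ.≤ ℕtoℚ n
scaled-≤⁺ {x} {P} {D} m n x≡ le = Fraction-≤⁺ {{m*n≢0 D 1}} (Fraction-* x≡ (Fraction-ℕ m)) (Fraction-ℕ n)
  (subst₂ _≤_ (sym (*-identityʳ (P * m))) (sym (trans (cong (n *_) (*-identityʳ D)) (*-comm n D))) le)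

Fraction-bound⁻ : ∀ p q → .{{_ : NonZero p}} → .{{_ : NonZero q}} → ∀ {ε F} → Fraction ε 1 F → ∀ X Z →
  (+ p ℚ./ q) ^ℚ p ℚ.* ε ^ℚ q ℚ.* ℕtoℚ X ^ℚ p ℚ.≤ ℕtoℚ Z ^ℚ p →
  X ^ p ≤ Z ^ p * (q ^ p * F ^ q)
Fraction-bound⁻ p q {ε} {F} ε≡ X Z le = begin
  X ^ p                          ≤⟨ m≤n*m (X ^ p) (p ^ p) {{m^n≢0 p p}} ⟩
  p ^ p * X ^ p                  ≡⟨ arith₁ (p ^ p) (X ^ p) ⟩
  p ^ p * 1 * X ^ p * 1          ≡⟨ cong₂ (λ a b → p ^ p * a * X ^ p * b) (sym (^-zeroˡ q)) (sym (^-zeroˡ p)) ⟩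
  p ^ p * 1 ^ q * X ^ p * 1 ^ p  ≤⟨ Fraction-≤⁻
    (Fraction-* (Fraction-* (Fraction-^ p (Fraction-/ p q)) (Fraction-^ q ε≡)) (Fraction-^ p (Fraction-ℕ X)))
    (Fraction-^ p (Fraction-ℕ Z)) le ⟩
  Z ^ p * (q ^ p * F ^ q * 1 ^ p) ≡⟨ cong (λ t → Z ^ p * (q ^ p * F ^ q * t)) (^-zeroˡ p) ⟩
  Z ^ p * (q ^ p * F ^ q * 1)    ≡⟨ cong (Z ^ p *_) (*-identityʳ _) ⟩
  Z ^ p * (q ^ p * F ^ q)        ∎
  where
  open ≤-Reasoning
  arith₁ : ∀ a x → a * x ≡ a * 1 * x * 1
  arith₁ = solve-∀

-- `X / Z` is at least `n`, so its `p`-th power cannot stay below `Y` unless `n` does.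
cubic-growth : ∀ p {n X Z Y} → .{{_ : NonZero p}} → .{{_ : NonZero n}} → n * (n * n) ≤ X → Z ≤ n * n →
  X ^ p ≤ Z ^ p * Y → n ≤ Y
cubic-growth p@(suc p′) {n} {X} {Z} {Y} n³≤X Z≤n² le = begin
  n          ≤⟨ m≤m*n n (n ^ p′) {{m^n≢0 n p′}} ⟩
  n ^ p      ≤⟨ *-cancelʳ-≤ (n ^ p) Y ((n * n) ^ p) {{m^n≢0 (n * n) p {{m*n≢0 n n}}}} (begin
    n ^ p * (n * n) ^ p   ≡⟨ sym (^-distribʳ-* p n (n * n)) ⟩
    (n * (n * n)) ^ p     ≤⟨ ^-monoˡ-≤ p n³≤X ⟩
    X ^ p                 ≤⟨ le ⟩
    Z ^ p * Y             ≤⟨ *-monoˡ-≤ Y (^-monoˡ-≤ p Z≤n²) ⟩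
    (n * n) ^ p * Y       ≡⟨ *-comm ((n * n) ^ p) Y ⟩
    Y * (n * n) ^ p       ∎) ⟩
  Y          ∎
  where open ≤-Reasoning

-- The number r of digits is chosen after q, so that n > d ^ r beats every
-- expression c₁ ^ q · d ^ (2 q), and d is taken large at the end.
module Counterexample (k g p q : ℕ) .{{_ : NonZero p}} .{{_ : NonZero q}} where

  L r c c₁ W d b M : ℕ
  L = suc (2 * suc k)
  r = 2 * q
  -- The constants are read off from `n ≡ c * b` and from `n * n ≡ c₁ * (d * d) * length cycles`, so
  -- the graph is used with `ε = 1 / (c₁ * (d * d))`.
  c = L * suc (g * L) * L
  c₁ = c * c * suc r * L ^ r
  W = q ^ p * c₁ ^ q
  d = suc W
  -- The bound of `val-bound`, rounded up so that `d * d` becomes a factor.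
  b = suc r * (d * d) * (L * d) ^ r
  -- This makes `M / n` equal to `g / suc (g * L)`, which is at least `γ = g / suc e` as soon as
  -- `g * L ≤ e`.
  M = g * L * (L * b)

  open Behrend L d

  val<b : (s : Vec (Fin d) r) → val s < b
  val<b s = ≤-trans (val-bound s) (*-monoˡ-≤ ((L * d) ^ r) (+-monoˡ-≤ (r * (d * d)) {1} {d * d} (s≤s z≤n)))

  open Construction k (allMaps d r) (allMaps-Unique d r) ∈-allMaps val val-average b val<b M public
    using (n; graph; minDegree; few-copies; cycles; cycles-copies; cycles-EdgeDisjoint; length-cycles)

  n≡cb : n ≡ c * b
  n≡cb = arith L g b
    where
    arith : ∀ L g b → L * (L * b + g * L * (L * b)) ≡ L * suc (g * L) * L * b
    arith = solve-∀

  g*n≡ : g * n ≡ suc (g * L) * M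
  g*n≡ = arith L g b
    where
    arith : ∀ L g b → g * (L * (L * b + g * L * (L * b))) ≡ suc (g * L) * (g * L * (L * b))
    arith = solve-∀

  many-cycles : n * n ≡ c₁ * (d * d) * length cycles
  many-cycles = begin
    n * n                                                          ≡⟨ cong₂ _*_ n≡cb n≡cb ⟩
    c * b * (c * b)                                                ≡⟨ cong (λ t → c * b * (c * (suc r * (d * d) * t))) (^-distribʳ-* r L d) ⟩
    c * b * (c * (suc r * (d * d) * (L ^ r * d ^ r)))              ≡⟨ arith c b (suc r) (d * d) (L ^ r) (d ^ r) ⟩
    c * c * suc r * L ^ r * (d * d) * (b * d ^ r)                  ≡⟨ cong (λ t → c₁ * (d * d) * (b * t)) (sym (length-allMaps d r)) ⟩
    c₁ * (d * d) * (b * length (allMaps d r))                      ≡⟨ cong (c₁ * (d * d) *_) (sym length-cycles) ⟩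
    c₁ * (d * d) * length cycles                                   ∎
    where
    open ≡-Reasoning
    arith : ∀ c b s x l y → c * b * (c * (s * x * (l * y))) ≡ c * c * s * l * x * (b * y)
    arith = solve-∀

  b≤n : b ≤ n
  b≤n = ≤-trans (m≤n*m b c) (≤-reflexive (sym n≡cb))

  n-positive : 0 < n
  n-positive = ≤-trans (>-nonZero⁻¹ b {{m*n≢0 (suc r * (d * d)) ((L * d) ^ r) {{_}} {{m^n≢0 (L * d) r}}}}) b≤n

  -- Since `r` is `2 * q`, `b` is at least `d * d * (d * d) ^ q`, whereas the right side is
  -- `W * (d * d) ^ q` with `W < d`.
  n-large : ¬ n ≤ q ^ p * (c₁ * (d * d)) ^ q
  n-large le = 1+n≰n (≤-trans (m≤m*n d d) (*-cancelʳ-≤ (d * d) W ((d * d) ^ q) {{m^n≢0 (d * d) q}} (begin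
    d * d * (d * d) ^ q                  ≡⟨ cong (d * d *_) (trans (cong (λ t → (d * t) ^ q) (sym (*-identityʳ d))) (^-*-assoc d 2 q)) ⟩
    d * d * d ^ r                        ≤⟨ *-mono-≤ (m≤n*m (d * d) (suc r)) (^-monoˡ-≤ r (m≤n*m d L)) ⟩
    b                                    ≤⟨ b≤n ⟩
    n                                    ≤⟨ le ⟩
    q ^ p * (c₁ * (d * d)) ^ q           ≡⟨ cong (q ^ p *_) (^-distribʳ-* q c₁ (d * d)) ⟩
    q ^ p * (c₁ ^ q * (d * d) ^ q)       ≡⟨ sym (*-assoc (q ^ p) _ _) ⟩
    W * (d * d) ^ q                      ∎)))
    where open ≤-Reasoning

¬polyRemoval-below : ∀ k {t γ g e} → Fraction t 1 (suc (2 * suc k)) → Fraction γ g (suc e) → γ ℚ.< t →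
  ¬ PolyRemoval (Cycle (suc (2 * suc k))) γ
¬polyRemoval-below k {t} {γ} {g} {e} t≡ γ≡ γ<t (p , q , nzp , nzq , removal) =
  n-large (cubic-growth p {{nzp}} {{>-nonZero n-positive}} n³≤n^L few-copies
    (Fraction-bound⁻ p q {{nzp}} {{nzq}} ε≡ (n ^ L) (copyCount (Cycle L) graph)
      (removal ε (ℚ.positive⁻¹ ε {{ℚ.normalize-pos 1 F}}) n graph dense
        (cycles , cycles-copies , cycles-EdgeDisjoint , scaled-≤⁺ (n * n) (length cycles) ε≡ (≤-reflexive (trans (*-identityˡ _) many-cycles))))))
  where
  open Counterexample k g p q {{nzp}} {{nzq}}
  F = c₁ * (d * d)
  instance
    F≢0 : NonZero F
    F≢0 = m*n≢0 c₁ (d * d) {{m*n≢0 (c * c * suc r) (L ^ r) {{_}} {{m^n≢0 L r}}}}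
  ε = + 1 ℚ./ F
  ε≡ : Fraction ε 1 F
  ε≡ = Fraction-/ 1 F
  n³≤n^L : n * (n * n) ≤ n ^ L
  n³≤n^L = ≤-trans (≤-reflexive (cong (λ t → n * (n * t)) (sym (*-identityʳ n)))) (^-monoʳ-≤ n {{>-nonZero n-positive}} {3} {L} (s≤s (*-monoʳ-≤ 2 {1} {suc k} (s≤s z≤n))))
  gL≤e : g * L ≤ e
  gL≤e = ≤-pred (≰⇒> λ le → ℚ.<-irrefl refl (ℚ.<-≤-trans γ<t (Fraction-≤⁺ t≡ γ≡ (≤-trans (≤-reflexive (*-identityˡ _)) le))))
  dense : MinDegreeAtLeast graph γ
  dense u = scaled-≤⁺ n (degree graph u) γ≡ (≤-trans (≤-reflexive g*n≡) (*-mono-≤ (s≤s gL≤e) (minDegree u)))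

theorem1p1 : (k : ℕ) → 1 ≤ k →
    IsPolyRemThreshold (Cycle (suc (2 * k))) (+ 1 / suc (2 * k))
theorem1p1 (suc k) _ =
  (λ γ t<γ _ → let (P , D , γ≡) = nonNeg⇒Fraction γ (ℚ.<⇒≤ (ℚ.≤-<-trans 0≤t t<γ))
               in polyRemoval-above k t≡ γ≡ t<γ) ,
  (λ γ 0≤γ γ<t → let (g , e , γ≡) = nonNeg⇒Fraction γ 0≤γ in ¬polyRemoval-below k t≡ γ≡ γ<t)
  where
  t≡ = Fraction-/ 1 (suc (2 * suc k))
  0≤t : 0ℚ ℚ.≤ + 1 ℚ./ suc (2 * suc k)
  0≤t = ℚ.nonNegative⁻¹ _ {{ℚ.normalize-nonNeg 1 (suc (2 * suc k))}}
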